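{- Let $q\geq5$ be an integer, let $n=5q$, and let $H_q$ be the graph with vertex set $\{a_i,b_i:i\in\mathbb Z_n\}$ and adjacencies $a_i\sim a_{i\pm1},a_{i\pm q},b_i$ and $b_i\sim b_{i\pm1},b_{i\pm2q},a_i$ for all $i\in\mathbb Z_n$ (subscripts modulo $n$). Then, for every $i\in\mathbb Z_n$, $$\kappa_0(a_i,a_{i+1})=\kappa_0(b_i,b_{i+1})=0,\qquad \kappa_0(a_i,a_{i+q})=\kappa_0(b_i,b_{i+2q})=\kappa_0(a_i,b_i)=-\tfrac15 .$$ Hence $H_q$ is not bone-idle.
   Context: $H_q$ is a simple connected $5$-regular graph on $2n=10q$ distinct vertices. For a connected graph with shortest-path distance $d$, vertex $x$ of degree $d_x$ with neighborhood $N(x)$, and $\alpha\in[0,1]$, let $\mu_x^\alpha$ be the probability measure with $\mu_x^\alpha(x)=\alpha$, $\mu_x^\alpha(z)=(1-\alpha)/d_x$ for $z\in N(x)$, and $0$ otherwise. For probability measures $\mu,\nu$ on $V$, $W_1(\mu,\nu)=\min_\pi\sum_{u,v\in V}d(u,v)\pi(u,v)$, the minimum being over all $\pi:V\times V\to[0,1]$ with marginals $\mu$ and $\nu$. For an edge $xy$, the Ollivier--Ricci curvature with idleness $\alpha$ is $\kappa_\alpha(x,y)=1-W_1(\mu_x^\alpha,\mu_y^\alpha)$; $\kappa_0$ is the case $\alpha=0$. An edge $xy$ is bone-idle if $\kappa_\alpha(x,y)=0$ for every $\alpha\in[0,1]$; a graph is bone-idle if each of its edges is bone-idle. -}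

module Defs where

open import Algebra.Bundles using (RawMonoid)
import Algebra.Definitions.RawMonoid as RawMonoidDefs
open import Data.Fin.Base using (Fin; toℕ)
import Data.Fin.Properties as Fin
import Data.Integer.Base as ℤ
open import Data.List.Base using (List; map; filter; length; allFin)
open import Data.List.Membership.Propositional using (_∈_)
open import Data.List.Membership.Propositional.Properties using (∈-map⁺; ∈-filter⁺; ∈-allFin; ∈-length)
open import Data.Nat.Base as ℕ using (ℕ; zero; suc; z≤n; s≤s; NonZero)
open import Data.Nat.DivMod using (_mod_; _%_; m<n⇒m%n≡m; [m+n]%n≡m%n; %-distribˡ-+; m%n%n≡m%n; m≤n⇒[n∸m]%m≡n%m)
import Data.Nat.Properties as ℕ
open import Data.Product.Base using (∃; _×_; _,_; proj₁; proj₂)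
open import Data.Rational.Base as ℚ using (ℚ; 0ℚ; 1ℚ; ½)
import Data.Rational.Properties as ℚ
open import Data.Rational.Solver renaming (module +-*-Solver to ℚ-Solver)
open import Data.Sum.Base using (_⊎_; inj₁; inj₂; [_,_]′)
import Data.Sum.Base as Sum
open import Function.Base using (_∘_)
open import Function.Bundles using (_↔_; module Inverse)
open import Function.Construct.Symmetry using (↔-sym)
open import Function.Properties.Inverse using (↔⇒↣)
open import Level using (0ℓ)
open import Relation.Binary.Definitions using () renaming (Decidable to Decidable₂; Symmetric to Symmetric₂; DecidableEquality to DecEq)
open import Relation.Binary.PropositionalEquality
open import Relation.Nullary using (¬_; Dec; yes; no; contradiction)
open import Relation.Nullary.Decidable using (map′; _×-dec_; _⊎-dec_; via-injection)
open import Relation.Unary using (Decidable)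

-- Real numbers are Cauchy sequences of rationals; their equality is _≈_, not _≡_.
-- Only the additive, ordered structure and division by a positive integer are needed.

IsCauchy : (ℕ → ℚ) → Set
IsCauchy s = ∀ ε → 0ℚ ℚ.< ε → ∃ λ N → ∀ m n → N ℕ.≤ m → N ℕ.≤ n →
             ℚ.∣ s m ℚ.- s n ∣ ℚ.≤ ε

record ℝ : Set where
  constructor mkℝ
  field
    seq    : ℕ → ℚ
    cauchy : IsCauchy seq

open ℝ public

infix 4 _≤_ _≈_

record _≤_ (x y : ℝ) : Set where
  constructor mk≤
  field
    bound : ∀ ε → 0ℚ ℚ.< ε → ∃ λ N → ∀ n → N ℕ.≤ n → seq x n ℚ.≤ seq y n ℚ.+ ε

record _≈_ (x y : ℝ) : Set where
  constructor mk≈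
  field
    ≤-fwd : x ≤ y
    ≤-bwd : y ≤ x

half-pos : ∀ {ε} → 0ℚ ℚ.< ε → 0ℚ ℚ.< ε ℚ.* ½
half-pos {ε} p = subst (ℚ._< ε ℚ.* ½) (ℚ.*-zeroˡ ½) (ℚ.*-monoˡ-<-pos ½ p)

half+half : ∀ ε → ε ℚ.* ½ ℚ.+ ε ℚ.* ½ ≡ ε
half+half ε = trans (sym (ℚ.*-distribˡ-+ ε ½ ½)) (ℚ.*-identityʳ ε)

diff-+ : ∀ a b c d → (a ℚ.+ b) ℚ.- (c ℚ.+ d) ≡ (a ℚ.- c) ℚ.+ (b ℚ.- d)
diff-+ = solve 4 (λ a b c d → (a :+ b) :- (c :+ d) := (a :- c) :+ (b :- d)) refl
  where open ℚ-Solver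

diff-neg : ∀ a b → (ℚ.- a) ℚ.- (ℚ.- b) ≡ ℚ.- (a ℚ.- b)
diff-neg = solve 2 (λ a b → (:- a) :- (:- b) := :- (a :- b)) refl
  where open ℚ-Solver

diff-* : ∀ a b c → a ℚ.* c ℚ.- b ℚ.* c ≡ (a ℚ.- b) ℚ.* c
diff-* = solve 3 (λ a b c → a :* c :- b :* c := (a :- b) :* c) refl
  where open ℚ-Solver

1/-nonNeg : ∀ d .{{_ : NonZero d}} → ℚ.NonNegative (ℤ.+ 1 ℚ./ d)
1/-nonNeg d = ℚ.nonNegative (ℚ.toℚᵘ-cancel-≤ (≤-by d))
  where
  import Data.Rational.Unnormalised.Base as ℚᵘ
  import Data.Rational.Unnormalised.Properties as ℚᵘ
  ≤-by : ∀ d .{{_ : NonZero d}} → ℚᵘ.0ℚᵘ ℚᵘ.≤ ℚ.toℚᵘ (ℤ.+ 1 ℚ./ d)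
  ≤-by (suc d) = ℚᵘ.≤-trans (ℚᵘ.nonNegative⁻¹ (ℤ.+ 1 ℚᵘ./ suc d))
                   (ℚᵘ.≤-reflexive (ℚᵘ.≃-sym (ℚ.toℚᵘ-fromℚᵘ (ℤ.+ 1 ℚᵘ./ suc d))))

1/-≤1 : ∀ d .{{_ : NonZero d}} → ℤ.+ 1 ℚ./ d ℚ.≤ 1ℚ
1/-≤1 (suc d) = ℚ.toℚᵘ-cancel-≤ (ℚᵘ.≤-trans
    (ℚᵘ.≤-reflexive (ℚ.toℚᵘ-fromℚᵘ (ℤ.+ 1 ℚᵘ./ suc d)))
    (ℚᵘ.*≤* (ℤ.+≤+ (s≤s z≤n))))
  where
  import Data.Rational.Unnormalised.Base as ℚᵘ
  import Data.Rational.Unnormalised.Properties as ℚᵘ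

-- The moduli are abstract so that they are never unfolded during conversion
-- checking; only the underlying sequences compute.
abstract
  const-cauchy : ∀ p → IsCauchy (λ _ → p)
  const-cauchy p ε 0<ε = 0 , λ _ _ _ _ →
    subst (ℚ._≤ ε) (cong ℚ.∣_∣ (sym (ℚ.+-inverseʳ p))) (ℚ.<⇒≤ 0<ε)

  +-cauchy : ∀ x y → IsCauchy (λ n → seq x n ℚ.+ seq y n)
  +-cauchy (mkℝ s cs) (mkℝ t ct) ε 0<ε =
    let (M , p) = cs (ε ℚ.* ½) (half-pos 0<ε)
        (N , q) = ct (ε ℚ.* ½) (half-pos 0<ε)
    in M ℕ.⊔ N , λ m n M⊔N≤m M⊔N≤n → begin
      ℚ.∣ (s m ℚ.+ t m) ℚ.- (s n ℚ.+ t n) ∣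
        ≡⟨ cong ℚ.∣_∣ (diff-+ (s m) (t m) (s n) (t n)) ⟩
      ℚ.∣ (s m ℚ.- s n) ℚ.+ (t m ℚ.- t n) ∣
        ≤⟨ ℚ.∣p+q∣≤∣p∣+∣q∣ (s m ℚ.- s n) (t m ℚ.- t n) ⟩
      ℚ.∣ s m ℚ.- s n ∣ ℚ.+ ℚ.∣ t m ℚ.- t n ∣
        ≤⟨ ℚ.+-mono-≤
             (p m n (ℕ.m⊔n≤o⇒m≤o M N M⊔N≤m) (ℕ.m⊔n≤o⇒m≤o M N M⊔N≤n))
             (q m n (ℕ.m⊔n≤o⇒n≤o M N M⊔N≤m) (ℕ.m⊔n≤o⇒n≤o M N M⊔N≤n)) ⟩
      ε ℚ.* ½ ℚ.+ ε ℚ.* ½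
        ≡⟨ half+half ε ⟩
      ε ∎
    where open ℚ.≤-Reasoning

  neg-cauchy : ∀ x → IsCauchy (λ n → ℚ.- seq x n)
  neg-cauchy (mkℝ s cs) ε 0<ε =
    let (N , p) = cs ε 0<ε
    in N , λ m n N≤m N≤n → subst (ℚ._≤ ε)
         (sym (trans (cong ℚ.∣_∣ (diff-neg (s m) (s n))) (ℚ.∣-p∣≡∣p∣ (s m ℚ.- s n))))
         (p m n N≤m N≤n)

  /-cauchy : ∀ x d .{{_ : NonZero d}} → IsCauchy (λ n → seq x n ℚ.* (ℤ.+ 1 ℚ./ d))
  /-cauchy (mkℝ s cs) d ε 0<ε =
    let (N , p) = cs ε 0<ε
    in N , λ m n N≤m N≤n → begin
      ℚ.∣ s m ℚ.* c ℚ.- s n ℚ.* c ∣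
        ≡⟨ cong ℚ.∣_∣ (diff-* (s m) (s n) c) ⟩
      ℚ.∣ (s m ℚ.- s n) ℚ.* c ∣
        ≡⟨ ℚ.∣p*q∣≡∣p∣*∣q∣ (s m ℚ.- s n) c ⟩
      ℚ.∣ s m ℚ.- s n ∣ ℚ.* ℚ.∣ c ∣
        ≡⟨ cong (ℚ.∣ s m ℚ.- s n ∣ ℚ.*_) (ℚ.0≤p⇒∣p∣≡p (ℚ.nonNegative⁻¹ c {{1/-nonNeg d}})) ⟩
      ℚ.∣ s m ℚ.- s n ∣ ℚ.* c
        ≤⟨ ℚ.*-monoˡ-≤-nonNeg ℚ.∣ s m ℚ.- s n ∣ {{ℚ.∣-∣-nonNeg (s m ℚ.- s n)}} (1/-≤1 d) ⟩
      ℚ.∣ s m ℚ.- s n ∣ ℚ.* 1ℚ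
        ≡⟨ ℚ.*-identityʳ _ ⟩
      ℚ.∣ s m ℚ.- s n ∣
        ≤⟨ p m n N≤m N≤n ⟩
      ε ∎
    where
    open ℚ.≤-Reasoning
    c : ℚ
    c = ℤ.+ 1 ℚ./ d

fromℚ : ℚ → ℝ
fromℚ p = mkℝ (λ _ → p) (const-cauchy p)

0ℝ 1ℝ : ℝ
0ℝ = fromℚ 0ℚ
1ℝ = fromℚ 1ℚ

infixl 6 _+_ _-_
infixl 7 _/_
infix  8 -_

_+_ : ℝ → ℝ → ℝ
x + y = mkℝ (λ n → seq x n ℚ.+ seq y n) (+-cauchy x y)

-_ : ℝ → ℝ
- x = mkℝ (λ n → ℚ.- seq x n) (neg-cauchy x)

_-_ : ℝ → ℝ → ℝ
x - y = x + (- y)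

_/_ : ℝ → (d : ℕ) .{{_ : NonZero d}} → ℝ
x / d = mkℝ (λ n → seq x n ℚ.* (ℤ.+ 1 ℚ./ d)) (/-cauchy x d)

+-rawMonoid : RawMonoid 0ℓ 0ℓ
+-rawMonoid = record { Carrier = ℝ ; _≈_ = _≈_ ; _∙_ = _+_ ; ε = 0ℝ }

-- n · x is the n-fold sum x + ⋯ + x.
open RawMonoidDefs +-rawMonoid public using (sum) renaming (_×_ to infixr 8 _·_)

data Walk {V : Set} (_~_ : V → V → Set) : ℕ → V → V → Set where
  []  : ∀ {x} → Walk _~_ 0 x x
  _∷_ : ∀ {k x y z} → x ~ y → Walk _~_ k y z → Walk _~_ (suc k) x z

-- Finite, simple, connected.
record Graph : Set₁ where
  infix 4 _~_ _~?_
  field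
    V         : Set
    order     : ℕ
    enum      : Fin order ↔ V
    _~_       : V → V → Set
    _~?_      : Decidable₂ _~_
    ~-sym     : Symmetric₂ _~_
    ~-irrefl  : ∀ {x} → ¬ (x ~ x)
    connected : ∀ x y → ∃ λ k → Walk _~_ k x y

least : {P : ℕ → Set} → Decidable P → ∀ k → P k →
        ∃ λ m → P m × (∀ j → P j → m ℕ.≤ j)
least P? zero p = zero , p , λ _ _ → z≤n
least {P} P? (suc k) p with P? 0
... | yes p₀ = 0 , p₀ , λ _ _ → z≤n
... | no ¬p₀ with least {P ∘ suc} (P? ∘ suc) k p
...   | m , pₘ , min = suc m , pₘ , λ where
          zero    p₀ → contradiction p₀ ¬p₀
          (suc j) pⱼ → s≤s (min j pⱼ)

module _ (G : Graph) where
  open Graph G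

  vertices : List V
  vertices = map (Inverse.to enum) (allFin order)

  ∈-vertices : ∀ x → x ∈ vertices
  ∈-vertices x = subst (_∈ vertices) (Inverse.strictlyInverseˡ enum x)
    (∈-map⁺ (Inverse.to enum) (∈-allFin (Inverse.from enum x)))

  _≟V_ : DecEq V
  _≟V_ = via-injection (↔⇒↣ (↔-sym enum)) Fin._≟_

  walk? : ∀ k x y → Dec (Walk _~_ k x y)
  walk? zero    x y = map′ (λ { refl → [] }) (λ { [] → refl }) (x ≟V y)
  walk? (suc k) x y = map′
    (λ { (_ , e , w) → e ∷ w })
    (λ { (_∷_ {y = z} e w) → Inverse.from enum z ,
           subst (λ v → x ~ v × Walk _~_ k v y) (sym (Inverse.strictlyInverseˡ enum z)) (e , w) })
    (Fin.any? λ i → (x ~? Inverse.to enum i) ×-dec walk? k (Inverse.to enum i) y)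

  dist : V → V → ℕ
  dist x y = let (k , w) = connected x y in proj₁ (least (λ k → walk? k x y) k w)

  degree : V → ℕ
  degree x = length (filter (x ~?_) vertices)

  ~⇒degree≢0 : ∀ {x y} → x ~ y → NonZero (degree x)
  ~⇒degree≢0 {x} {y} e = ℕ.>-nonZero (∈-length (∈-filter⁺ (x ~?_) (∈-vertices y) e))

  ∑ : (V → ℝ) → ℝ
  ∑ f = sum (f ∘ Inverse.to enum)

  mass : ∀ {x z} → ℝ → Dec (x ≡ z) → Dec (x ~ z) → ℝ
  mass     α (yes _) _       = α
  mass {x} α (no _)  (yes e) = _/_ (1ℝ - α) (degree x) {{~⇒degree≢0 e}}
  mass     α (no _)  (no _)  = 0ℝ

  μ : ℝ → V → V → ℝ
  μ α x z = mass α (x ≟V z) (x ~? z)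

  record IsCoupling (ρ σ : V → ℝ) (π : V → V → ℝ) : Set where
    field
      0≤π       : ∀ u v → 0ℝ ≤ π u v
      π≤1       : ∀ u v → π u v ≤ 1ℝ
      marginalˡ : ∀ u → ∑ (λ v → π u v) ≈ ρ u
      marginalʳ : ∀ v → ∑ (λ u → π u v) ≈ σ v

  cost : (V → V → ℝ) → ℝ
  cost π = ∑ λ u → ∑ λ v → dist u v · π u v

  -- W₁ and κ_α are relations, "the minimum exists and is w" and "κ_α(x,y) = k",
  -- since a minimising coupling cannot be computed from arbitrary real data.
  IsW₁ : (ρ σ : V → ℝ) → ℝ → Set
  IsW₁ ρ σ w = (∃ λ π → IsCoupling ρ σ π × cost π ≈ w)
             × (∀ π → IsCoupling ρ σ π → w ≤ cost π)

  IsCurvature : (α : ℝ) (x y : V) (k : ℝ) → Set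
  IsCurvature α x y k = ∃ λ w → IsW₁ (μ α x) (μ α y) w × k ≈ 1ℝ - w

  BoneIdle : Set
  BoneIdle = ∀ x y → x ~ y → ∀ α → 0ℝ ≤ α → α ≤ 1ℝ → IsCurvature α x y 0ℝ

infixl 6 _⊕_

-- Addition of a natural number in ℤ/n, with Fin n as the set of residues.
_⊕_ : ∀ {n} → Fin n → ℕ → Fin n
_⊕_ {n} i k = _mod_ (toℕ i ℕ.+ k) n {{Fin.nonZeroIndex i}}

-- j = i ± k; the second disjunct says j = i - k without a subtraction on Fin n.
_≡_±_ : ∀ {n} → Fin n → Fin n → ℕ → Set
j ≡ i ± k = j ≡ i ⊕ k ⊎ i ≡ j ⊕ k

pattern a i = inj₁ i
pattern b i = inj₂ i

-- a i and b i are the vertices a_i and b_i, with i ∈ ℤ/5q.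
Adj : ∀ q → let n = 5 ℕ.* q in Fin n ⊎ Fin n → Fin n ⊎ Fin n → Set
Adj q (a i) (a j) = j ≡ i ± 1 ⊎ j ≡ i ± q
Adj q (b i) (b j) = j ≡ i ± 1 ⊎ j ≡ i ± (2 ℕ.* q)
Adj q (a i) (b j) = i ≡ j
Adj q (b i) (a j) = i ≡ j

toℕ-⊕ : ∀ {n} (i : Fin n) k .{{_ : NonZero n}} → toℕ (i ⊕ k) ≡ (toℕ i ℕ.+ k) % n
toℕ-⊕ i k = Fin.toℕ-fromℕ< _

⊕-0 : ∀ {n} (i : Fin n) → i ⊕ 0 ≡ i
⊕-0 {n} i = Fin.toℕ-injective (begin
    toℕ (i ⊕ 0)        ≡⟨ toℕ-⊕ i 0 ⟩
    (toℕ i ℕ.+ 0) % n  ≡⟨ cong (_% n) (ℕ.+-identityʳ (toℕ i)) ⟩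
    toℕ i % n          ≡⟨ m<n⇒m%n≡m (Fin.toℕ<n i) ⟩
    toℕ i              ∎)
  where
  open ≡-Reasoning
  instance _ = Fin.nonZeroIndex i

⊕-1 : ∀ {n} (i : Fin n) k → i ⊕ suc k ≡ (i ⊕ 1) ⊕ k
⊕-1 {n} i k = Fin.toℕ-injective (begin
    toℕ (i ⊕ suc k)                                ≡⟨ toℕ-⊕ i (suc k) ⟩
    (toℕ i ℕ.+ suc k) % n                          ≡⟨ cong (_% n) (sym (ℕ.+-assoc (toℕ i) 1 k)) ⟩
    (toℕ i ℕ.+ 1 ℕ.+ k) % n                        ≡⟨ %-distribˡ-+ (toℕ i ℕ.+ 1) k n ⟩
    ((toℕ i ℕ.+ 1) % n ℕ.+ k % n) % n              ≡⟨ cong (λ t → (t ℕ.+ k % n) % n) (sym (m%n%n≡m%n (toℕ i ℕ.+ 1) n)) ⟩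
    ((toℕ i ℕ.+ 1) % n % n ℕ.+ k % n) % n          ≡⟨ sym (%-distribˡ-+ ((toℕ i ℕ.+ 1) % n) k n) ⟩
    ((toℕ i ℕ.+ 1) % n ℕ.+ k) % n                  ≡⟨ cong (λ t → (t ℕ.+ k) % n) (sym (toℕ-⊕ i 1)) ⟩
    (toℕ (i ⊕ 1) ℕ.+ k) % n                        ≡⟨ sym (toℕ-⊕ (i ⊕ 1) k) ⟩
    toℕ ((i ⊕ 1) ⊕ k)                              ∎)
  where
  open ≡-Reasoning
  instance _ = Fin.nonZeroIndex i

i⊕k≢i : ∀ {n} (i : Fin n) k → 0 ℕ.< k → k ℕ.< n → ¬ (i ≡ i ⊕ k)
i⊕k≢i {n} i k 0<k k<n eq with (toℕ i ℕ.+ k) ℕ.<? n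
... | yes lt = ℕ.<⇒≢ (ℕ.m<m+n (toℕ i) 0<k) (trans (cong toℕ eq) (trans (toℕ-⊕ i k) (m<n⇒m%n≡m lt)))
  where instance _ = Fin.nonZeroIndex i
... | no ≮ = ℕ.<⇒≢ k<n (ℕ.+-cancelˡ-≡ (toℕ i) k n (trans (sym (ℕ.m∸n+n≡m n≤)) (cong (ℕ._+ n) (sym i≡))))
  where
  instance _ = Fin.nonZeroIndex i
  n≤ = ℕ.≮⇒≥ ≮
  small : toℕ i ℕ.+ k ℕ.∸ n ℕ.< n
  small = ℕ.+-cancelʳ-< n _ n (subst (ℕ._< n ℕ.+ n) (sym (ℕ.m∸n+n≡m n≤)) (ℕ.+-mono-< (Fin.toℕ<n i) k<n))
  i≡ : toℕ i ≡ toℕ i ℕ.+ k ℕ.∸ n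
  i≡ = trans (cong toℕ eq) (trans (toℕ-⊕ i k)
         (trans (sym (m≤n⇒[n∸m]%m≡n%m n≤)) (m<n⇒m%n≡m small)))

⊕-reach : ∀ {n} (i j : Fin n) → i ⊕ (n ℕ.∸ toℕ i ℕ.+ toℕ j) ≡ j
⊕-reach {n} i j = Fin.toℕ-injective (begin
    toℕ (i ⊕ (n ℕ.∸ toℕ i ℕ.+ toℕ j))            ≡⟨ toℕ-⊕ i _ ⟩
    (toℕ i ℕ.+ (n ℕ.∸ toℕ i ℕ.+ toℕ j)) % n      ≡⟨ cong (_% n) (sym (ℕ.+-assoc (toℕ i) _ (toℕ j))) ⟩
    (toℕ i ℕ.+ (n ℕ.∸ toℕ i) ℕ.+ toℕ j) % n      ≡⟨ cong (λ t → (t ℕ.+ toℕ j) % n) (ℕ.m+[n∸m]≡n (ℕ.<⇒≤ (Fin.toℕ<n i))) ⟩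
    (n ℕ.+ toℕ j) % n                            ≡⟨ cong (_% n) (ℕ.+-comm n (toℕ j)) ⟩
    (toℕ j ℕ.+ n) % n                            ≡⟨ [m+n]%n≡m%n (toℕ j) n ⟩
    toℕ j % n                                    ≡⟨ m<n⇒m%n≡m (Fin.toℕ<n j) ⟩
    toℕ j                                        ∎)
  where
  open ≡-Reasoning
  instance _ = Fin.nonZeroIndex i

walk-a : ∀ q (i : Fin (5 ℕ.* q)) k → Walk (Adj q) k (a i) (a (i ⊕ k))
walk-a q i zero    = subst (λ j → Walk (Adj q) 0 (a i) (a j)) (sym (⊕-0 i)) []
walk-a q i (suc k) = subst (λ j → Walk (Adj q) (suc k) (a i) (a j)) (sym (⊕-1 i k))
                       (inj₁ (inj₁ refl) ∷ walk-a q (i ⊕ 1) k)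

walk-b : ∀ q (i : Fin (5 ℕ.* q)) k → Walk (Adj q) k (b i) (b (i ⊕ k))
walk-b q i zero    = subst (λ j → Walk (Adj q) 0 (b i) (b j)) (sym (⊕-0 i)) []
walk-b q i (suc k) = subst (λ j → Walk (Adj q) (suc k) (b i) (b j)) (sym (⊕-1 i k))
                       (inj₁ (inj₁ refl) ∷ walk-b q (i ⊕ 1) k)

Adj-connected : ∀ q x y → ∃ λ k → Walk (Adj q) k x y
Adj-connected q (a i) (a j) = let k = 5 ℕ.* q ℕ.∸ toℕ i ℕ.+ toℕ j in
  k , subst (λ t → Walk (Adj q) k (a i) (a t)) (⊕-reach i j) (walk-a q i k)
Adj-connected q (b i) (b j) = let k = 5 ℕ.* q ℕ.∸ toℕ i ℕ.+ toℕ j in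
  k , subst (λ t → Walk (Adj q) k (b i) (b t)) (⊕-reach i j) (walk-b q i k)
Adj-connected q (a i) (b j) = _ , _∷_ {y = b i} refl (proj₂ (Adj-connected q (b i) (b j)))
Adj-connected q (b i) (a j) = _ , _∷_ {y = a i} refl (proj₂ (Adj-connected q (a i) (a j)))

Adj-sym : ∀ q → Symmetric₂ (Adj q)
Adj-sym q {a i} {a j} = Sum.map Sum.swap Sum.swap
Adj-sym q {b i} {b j} = Sum.map Sum.swap Sum.swap
Adj-sym q {a i} {b j} = sym
Adj-sym q {b i} {a j} = sym

±? : ∀ {n} (j i : Fin n) k → Dec (j ≡ i ± k)
±? j i k = (j Fin.≟ i ⊕ k) ⊎-dec (i Fin.≟ j ⊕ k)

Adj? : ∀ q → Decidable₂ (Adj q)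
Adj? q (a i) (a j) = ±? j i 1 ⊎-dec ±? j i q
Adj? q (b i) (b j) = ±? j i 1 ⊎-dec ±? j i (2 ℕ.* q)
Adj? q (a i) (b j) = i Fin.≟ j
Adj? q (b i) (a j) = i Fin.≟ j

Adj-irrefl : ∀ q → 5 ℕ.≤ q → ∀ {x} → ¬ Adj q x x
Adj-irrefl q q≥5 = irrefl
  where
  ±-irrefl : ∀ {n} (i : Fin n) k → 0 ℕ.< k → k ℕ.< n → ¬ (i ≡ i ± k)
  ±-irrefl i k p r = [ i⊕k≢i i k p r , i⊕k≢i i k p r ]′
  0<q : 0 ℕ.< q
  0<q = ℕ.≤-trans (s≤s z≤n) q≥5
  instance _ = ℕ.>-nonZero 0<q
  2q<5q : 2 ℕ.* q ℕ.< 5 ℕ.* q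
  2q<5q = ℕ.*-monoˡ-< q {2} {5} (s≤s (s≤s (s≤s z≤n)))
  0<2q : 0 ℕ.< 2 ℕ.* q
  0<2q = ℕ.≤-trans 0<q (ℕ.m≤m+n q _)
  q<5q : q ℕ.< 5 ℕ.* q
  q<5q = ℕ.≤-<-trans (ℕ.m≤m+n q _) 2q<5q
  1<5q : 1 ℕ.< 5 ℕ.* q
  1<5q = ℕ.≤-<-trans 0<q q<5q
  irrefl : ∀ {x} → ¬ Adj q x x
  irrefl {a i} = [ ±-irrefl i 1 (s≤s z≤n) 1<5q , ±-irrefl i q 0<q q<5q ]′
  irrefl {b i} = [ ±-irrefl i 1 (s≤s z≤n) 1<5q , ±-irrefl i (2 ℕ.* q) 0<2q 2q<5q ]′

H : ∀ q → 5 ℕ.≤ q → Graph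
H q q≥5 = record
  { V         = Fin (5 ℕ.* q) ⊎ Fin (5 ℕ.* q)
  ; order     = 5 ℕ.* q ℕ.+ 5 ℕ.* q
  ; enum      = Fin.+↔⊎
  ; _~_       = Adj q
  ; _~?_      = Adj? q
  ; ~-sym     = λ {x} {y} → Adj-sym q {x} {y}
  ; ~-irrefl  = λ {x} → Adj-irrefl q q≥5 {x}
  ; connected = Adj-connected q
  }

{-# OPTIONS --safe #-}
module Submission where

-- Transport cost between two uniform measures on d neighbours is bounded above by matching the
-- neighbours and below by Kantorovich potentials. For a_i a_{i+1} and b_i b_{i+1} the neighbours are
-- matched along edges, and the neighbourhoods are disjoint, so W₁ = 1. For the other edges xy there
-- are two neighbours of x whose only neighbour in N(y) is x itself: a_{i-q} and b_i for a_i a_{i+q},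
-- b_{i-2q} and a_i for b_i b_{i+2q}, a_{i+q} and a_{i-q} for a_i b_i. One of them must travel at
-- least 2, which is seen by the potential equal to 2 on these two vertices and 1 on the rest of N(x),
-- against 1 at x and 0 on the rest of N(y). Matchings with a single pair at distance 2 exist, so
-- W₁ = 6/5.

open import Defs
open import Algebra.Bundles using (CommutativeMonoid)
import Algebra.Properties.CommutativeMonoid.Mult as Mult
import Algebra.Properties.CommutativeMonoid.Sum as ∑
open import Data.Fin.Base using (Fin; zero; suc; toℕ; fromℕ<; punchIn)
open import Data.Fin.Patterns using (0F; 1F; 2F; 3F; 4F)
import Data.Fin.Properties as Fin
import Data.Integer.Base as ℤ
open import Data.List.Base using (tabulate; filter)
open import Data.List.Membership.Propositional using (_∈_)
open import Data.List.Membership.Propositional.Properties using (∈-filter⁺; ∈-filter⁻; ∈-tabulate⁺; ∈-tabulate⁻)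
open import Data.List.Membership.Propositional.Properties.WithK using (unique∧set⇒bag)
open import Data.List.Properties using (length-tabulate)
open import Data.List.Relation.Binary.BagAndSetEquality using (∼bag⇒↭)
open import Data.List.Relation.Binary.Permutation.Propositional.Properties using (↭-length)
import Data.List.Relation.Unary.Unique.Propositional.Properties as Unique
open import Data.Nat.Base as ℕ using (ℕ; zero; suc; z≤n; s≤s; NonZero)
open import Data.Nat.DivMod using (_%_; [m+kn]%n≡m%n; m<n⇒m%n≡m; m≡m%n+[m/n]*n) renaming (_/_ to _/ℕ_)
import Data.Nat.Properties as ℕ
open import Data.Nat.Solver using () renaming (module +-*-Solver to ℕ-Solver)
open import Data.Product.Base using (∃; _×_; _,_; proj₁; proj₂)
import Data.Product.Properties as Product
import Data.Rational.Base as ℚ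
import Data.Rational.Properties as ℚ
open import Data.Rational.Solver using () renaming (module +-*-Solver to ℚ-Solver)
open import Data.Sum.Base as Sum using (_⊎_; inj₁; inj₂)
import Data.Sum.Properties as Sum
open import Data.Vec.Base using ([]; _∷_; lookup)
open import Function.Base using (_∘_)
open import Function.Bundles using (module Inverse; module Injection; mk⇔)
open import Function.Properties.Inverse using (↔⇒↣)
open import Level using (0ℓ)
open import Relation.Binary.Bundles using (Poset)
open import Relation.Binary.Definitions using (DecidableEquality)
open import Relation.Binary.PropositionalEquality using (_≡_; _≢_; refl; sym; trans; cong; cong₂; subst; subst₂; module ≡-Reasoning)
import Relation.Binary.Reasoning.PartialOrder
open import Relation.Nullary using (¬_; Dec; yes; no; contradiction)
open import Relation.Nullary.Decidable using (_×-dec_; _→-dec_; map′; toWitness; toWitnessFalse)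
open import Algebra.Definitions.RawMonoid ℕ.+-0-rawMonoid using () renaming (sum to sumℕ)

-- The ordered commutative monoid of reals

pointwise-≤ : ∀ {x y} → (∀ n → seq x n ℚ.≤ seq y n) → x ≤ y
pointwise-≤ {x} {y} h = mk≤ λ ε 0<ε → 0 , λ n _ → ℚ.≤-trans (h n)
  (subst (ℚ._≤ seq y n ℚ.+ ε) (ℚ.+-identityʳ (seq y n)) (ℚ.+-monoʳ-≤ (seq y n) (ℚ.<⇒≤ 0<ε)))

pointwise-≈ : ∀ {x y} → (∀ n → seq x n ≡ seq y n) → x ≈ y
pointwise-≈ h = mk≈ (pointwise-≤ (ℚ.≤-reflexive ∘ h)) (pointwise-≤ (ℚ.≤-reflexive ∘ sym ∘ h))

≤-trans : ∀ {x y z} → x ≤ y → y ≤ z → x ≤ z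
≤-trans {x} {y} {z} (mk≤ p) (mk≤ q) = mk≤ λ ε 0<ε →
  let (M , p′) = p (ε ℚ.* ℚ.½) (half-pos 0<ε)
      (N , q′) = q (ε ℚ.* ℚ.½) (half-pos 0<ε)
  in M ℕ.⊔ N , λ n M⊔N≤n → begin
    seq x n                                ≤⟨ p′ n (ℕ.m⊔n≤o⇒m≤o M N M⊔N≤n) ⟩
    seq y n ℚ.+ ε ℚ.* ℚ.½                  ≤⟨ ℚ.+-monoˡ-≤ _ (q′ n (ℕ.m⊔n≤o⇒n≤o M N M⊔N≤n)) ⟩
    seq z n ℚ.+ ε ℚ.* ℚ.½ ℚ.+ ε ℚ.* ℚ.½    ≡⟨ ℚ.+-assoc (seq z n) _ _ ⟩
    seq z n ℚ.+ (ε ℚ.* ℚ.½ ℚ.+ ε ℚ.* ℚ.½)  ≡⟨ cong (seq z n ℚ.+_) (half+half ε) ⟩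
    seq z n ℚ.+ ε                          ∎
  where open ℚ.≤-Reasoning

≤-refl : ∀ {x} → x ≤ x
≤-refl = pointwise-≤ λ _ → ℚ.≤-refl

≈-refl : ∀ {x} → x ≈ x
≈-refl = mk≈ ≤-refl ≤-refl

≈-sym : ∀ {x y} → x ≈ y → y ≈ x
≈-sym (mk≈ p q) = mk≈ q p

≈-trans : ∀ {x y z} → x ≈ y → y ≈ z → x ≈ z
≈-trans (mk≈ p q) (mk≈ p′ q′) = mk≈ (≤-trans p p′) (≤-trans q′ q)

≤-poset : Poset 0ℓ 0ℓ 0ℓ
≤-poset = record
  { Carrier = ℝ ; _≈_ = _≈_ ; _≤_ = _≤_
  ; isPartialOrder = record
    { isPreorder = record
      { isEquivalence = record { refl = ≈-refl ; sym = ≈-sym ; trans = ≈-trans }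
      ; reflexive     = _≈_.≤-fwd
      ; trans         = ≤-trans
      }
    ; antisym = mk≈
    }
  }

module ≤-Reasoning = Relation.Binary.Reasoning.PartialOrder ≤-poset

+-mono-≤ : ∀ {x y u v} → x ≤ y → u ≤ v → x + u ≤ y + v
+-mono-≤ {x} {y} {u} {v} (mk≤ p) (mk≤ q) = mk≤ λ ε 0<ε →
  let (M , p′) = p (ε ℚ.* ℚ.½) (half-pos 0<ε)
      (N , q′) = q (ε ℚ.* ℚ.½) (half-pos 0<ε)
  in M ℕ.⊔ N , λ n M⊔N≤n → begin
    seq x n ℚ.+ seq u n
      ≤⟨ ℚ.+-mono-≤ (p′ n (ℕ.m⊔n≤o⇒m≤o M N M⊔N≤n)) (q′ n (ℕ.m⊔n≤o⇒n≤o M N M⊔N≤n)) ⟩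
    (seq y n ℚ.+ ε ℚ.* ℚ.½) ℚ.+ (seq v n ℚ.+ ε ℚ.* ℚ.½)
      ≡⟨ interchange (seq y n) (ε ℚ.* ℚ.½) (seq v n) (ε ℚ.* ℚ.½) ⟩
    (seq y n ℚ.+ seq v n) ℚ.+ (ε ℚ.* ℚ.½ ℚ.+ ε ℚ.* ℚ.½)
      ≡⟨ cong (seq y n ℚ.+ seq v n ℚ.+_) (half+half ε) ⟩
    seq y n ℚ.+ seq v n ℚ.+ ε ∎
  where
  open ℚ.≤-Reasoning
  interchange : ∀ a b c d → (a ℚ.+ b) ℚ.+ (c ℚ.+ d) ≡ (a ℚ.+ c) ℚ.+ (b ℚ.+ d)
  interchange = solve 4 (λ a b c d → (a :+ b) :+ (c :+ d) := (a :+ c) :+ (b :+ d)) refl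
    where open ℚ-Solver

+-cong : ∀ {x y u v} → x ≈ y → u ≈ v → x + u ≈ y + v
+-cong (mk≈ p q) (mk≈ p′ q′) = mk≈ (+-mono-≤ p p′) (+-mono-≤ q q′)

+-0-commutativeMonoid : CommutativeMonoid 0ℓ 0ℓ
+-0-commutativeMonoid = record
  { Carrier = ℝ ; _≈_ = _≈_ ; _∙_ = _+_ ; ε = 0ℝ
  ; isCommutativeMonoid = record
    { isMonoid = record
      { isSemigroup = record
        { isMagma = record { isEquivalence = Poset.isEquivalence ≤-poset ; ∙-cong = +-cong }
        ; assoc   = λ x y z → pointwise-≈ λ n → ℚ.+-assoc (seq x n) (seq y n) (seq z n)
        }
      ; identity = (λ x → pointwise-≈ λ n → ℚ.+-identityˡ (seq x n))
                 , (λ x → pointwise-≈ λ n → ℚ.+-identityʳ (seq x n))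
      }
    ; comm = λ x y → pointwise-≈ λ n → ℚ.+-comm (seq x n) (seq y n)
    }
  }

open CommutativeMonoid +-0-commutativeMonoid using (identityˡ; identityʳ)
open Mult +-0-commutativeMonoid using (×-congʳ; ×-homo-+; ×-distrib-+)
open ∑ +-0-commutativeMonoid using (sum-cong-≋; sum-remove; sum-replicate-zero; ∑-comm; ∑-distrib-+)

+-cancelʳ-≤ : ∀ {x y} z → x + z ≤ y + z → x ≤ y
+-cancelʳ-≤ {x} {y} z x+z≤y+z = begin
  x          ≈⟨ pointwise-≈ (λ n → cancel (seq x n) (seq z n)) ⟩
  x + z - z  ≤⟨ +-mono-≤ x+z≤y+z ≤-refl ⟩
  y + z - z  ≈⟨ pointwise-≈ (λ n → cancel (seq y n) (seq z n)) ⟨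
  y          ∎
  where
  open ≤-Reasoning
  cancel : ∀ p q → p ≡ p ℚ.+ q ℚ.- q
  cancel = solve 2 (λ p q → p := p :+ q :- q) refl
    where open ℚ-Solver

-‿antimono-≤ : ∀ {x y} → x ≤ y → - y ≤ - x
-‿antimono-≤ {x} {y} x≤y = begin
  - y            ≈⟨ pointwise-≈ (λ n → lhs (seq x n) (seq y n)) ⟩
  x + (- x - y)  ≤⟨ +-mono-≤ x≤y ≤-refl ⟩
  y + (- x - y)  ≈⟨ pointwise-≈ (λ n → rhs (seq x n) (seq y n)) ⟨
  - x            ∎
  where
  open ≤-Reasoning
  open ℚ-Solver
  lhs : ∀ p q → ℚ.- q ≡ p ℚ.+ (ℚ.- p ℚ.- q)
  lhs = solve 2 (λ p q → :- q := p :+ (:- p :- q)) refl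
  rhs : ∀ p q → ℚ.- p ≡ q ℚ.+ (ℚ.- p ℚ.- q)
  rhs = solve 2 (λ p q → :- p := q :+ (:- p :- q)) refl

1-‿cong : ∀ {x y} → x ≈ y → 1ℝ - x ≈ 1ℝ - y
1-‿cong (mk≈ p q) = +-cong ≈-refl (mk≈ (-‿antimono-≤ q) (-‿antimono-≤ p))

·-monoʳ-≤ : ∀ n {x y} → x ≤ y → n · x ≤ n · y
·-monoʳ-≤ zero    x≤y = ≤-refl
·-monoʳ-≤ (suc n) x≤y = +-mono-≤ x≤y (·-monoʳ-≤ n x≤y)

·-zeroʳ : ∀ n → n · 0ℝ ≈ 0ℝ
·-zeroʳ zero    = ≈-refl
·-zeroʳ (suc n) = ≈-trans (identityˡ _) (·-zeroʳ n)

0≤· : ∀ n {x} → 0ℝ ≤ x → 0ℝ ≤ n · x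
0≤· n 0≤x = ≤-trans (_≈_.≤-bwd (·-zeroʳ n)) (·-monoʳ-≤ n 0≤x)

·-monoˡ-≤ : ∀ {m n x} → 0ℝ ≤ x → m ℕ.≤ n → m · x ≤ n · x
·-monoˡ-≤ {n = n} 0≤x z≤n       = 0≤· n 0≤x
·-monoˡ-≤         0≤x (s≤s m≤n) = +-mono-≤ ≤-refl (·-monoˡ-≤ 0≤x m≤n)

sum-mono-≤ : ∀ {n} {f g : Fin n → ℝ} → (∀ i → f i ≤ g i) → sum f ≤ sum g
sum-mono-≤ {zero}  f≤g = ≤-refl
sum-mono-≤ {suc n} f≤g = +-mono-≤ (f≤g zero) (sum-mono-≤ (f≤g ∘ suc))

sum-0 : ∀ {n} {f : Fin n → ℝ} → (∀ i → f i ≈ 0ℝ) → sum f ≈ 0ℝ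
sum-0 {n} f≈0 = ≈-trans (sum-cong-≋ f≈0) (sum-replicate-zero n)

sum-single : ∀ {n} {f : Fin n → ℝ} i → (∀ j → j ≢ i → f j ≈ 0ℝ) → sum f ≈ f i
sum-single {suc n} {f} i f≈0 = begin-equality
  sum f                          ≈⟨ sum-remove {i = i} f ⟩
  f i + sum (f ∘ punchIn i)      ≈⟨ +-cong ≈-refl (sum-0 λ j → f≈0 _ (Fin.punchInᵢ≢i i j)) ⟩
  f i + 0ℝ                       ≈⟨ identityʳ (f i) ⟩
  f i                            ∎
  where open ≤-Reasoning

0≤sum : ∀ {n} {f : Fin n → ℝ} → (∀ i → 0ℝ ≤ f i) → 0ℝ ≤ sum f
0≤sum {zero}  0≤f = ≤-refl
0≤sum {suc n} 0≤f = ≤-trans (_≈_.≤-bwd (identityˡ 0ℝ)) (+-mono-≤ (0≤f zero) (0≤sum (0≤f ∘ suc)))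

term≤sum : ∀ {n} {f : Fin n → ℝ} → (∀ i → 0ℝ ≤ f i) → ∀ i → f i ≤ sum f
term≤sum {suc n} {f} 0≤f i = begin
  f i                        ≈⟨ identityʳ (f i) ⟨
  f i + 0ℝ                   ≤⟨ +-mono-≤ ≤-refl (0≤sum (0≤f ∘ punchIn i)) ⟩
  f i + sum (f ∘ punchIn i)  ≈⟨ sum-remove {i = i} f ⟨
  sum f                      ∎
  where open ≤-Reasoning

·-distrib-sum : ∀ m {n} (f : Fin n → ℝ) → m · sum f ≈ sum (λ i → m · f i)
·-distrib-sum m {zero}  f = ·-zeroʳ m
·-distrib-sum m {suc n} f =
  ≈-trans (×-distrib-+ (f zero) _ m) (+-cong ≈-refl (·-distrib-sum m (f ∘ suc)))

sum-· : ∀ {n} (f : Fin n → ℕ) x → sum (λ i → f i · x) ≈ sumℕ f · x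
sum-· {zero}  f x = ≈-refl
sum-· {suc n} f x = ≈-trans (+-cong ≈-refl (sum-· (f ∘ suc) x)) (≈-sym (×-homo-+ x (f zero) _))

-- Transport between uniform measures on neighbourhoods

-- The indicator of `P` scaled by `c`. It takes the decision itself, so case analysis replaces a
-- product of reals.
weight : ∀ {P : Set} → ℝ → Dec P → ℝ
weight c (yes _) = c
weight c (no  _) = 0ℝ

module _ {P : Set} {c : ℝ} where

  weight-yes : (P? : Dec P) → P → weight c P? ≈ c
  weight-yes (yes _) p = ≈-refl
  weight-yes (no ¬p) p = contradiction p ¬p

  weight-no : (P? : Dec P) → ¬ P → weight c P? ≈ 0ℝ
  weight-no (yes p) ¬p = contradiction p ¬p
  weight-no (no _)  ¬p = ≈-refl

  0≤weight : 0ℝ ≤ c → (P? : Dec P) → 0ℝ ≤ weight c P?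
  0≤weight 0≤c (yes _) = 0≤c
  0≤weight 0≤c (no _)  = ≤-refl

weight-⇔ : ∀ {P Q c} (P? : Dec P) (Q? : Dec Q) → (P → Q) → (Q → P) → weight c P? ≈ weight c Q?
weight-⇔ (yes p) Q? to from = ≈-sym (weight-yes Q? (to p))
weight-⇔ (no ¬p) Q? to from = ≈-sym (weight-no Q? (¬p ∘ from))

module _ (G : Graph) where
  open Graph G

  private
    _≟_ = _≟V_ G
    d   = dist G

  dist-walk : ∀ x y → Walk _~_ (d x y) x y
  dist-walk x y = let (k , w) = connected x y in
    proj₁ (proj₂ (least (λ k → walk? G k x y) k w))

  dist-≤ : ∀ {k x y} → Walk _~_ k x y → d x y ℕ.≤ k
  dist-≤ {k} {x} {y} w = let (l , v) = connected x y in
    proj₂ (proj₂ (least (λ k → walk? G k x y) l v)) k w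

  ∑-cong : ∀ {f g : V → ℝ} → (∀ u → f u ≈ g u) → ∑ G f ≈ ∑ G g
  ∑-cong f≈g = sum-cong-≋ λ i → f≈g (Inverse.to enum i)

  ∑-mono-≤ : ∀ {f g : V → ℝ} → (∀ u → f u ≤ g u) → ∑ G f ≤ ∑ G g
  ∑-mono-≤ f≤g = sum-mono-≤ λ i → f≤g (Inverse.to enum i)

  ∑-0 : ∀ {f : V → ℝ} → (∀ u → f u ≈ 0ℝ) → ∑ G f ≈ 0ℝ
  ∑-0 f≈0 = sum-0 λ i → f≈0 (Inverse.to enum i)

  ∑-single : ∀ {f : V → ℝ} x → (∀ u → u ≢ x → f u ≈ 0ℝ) → ∑ G f ≈ f x
  ∑-single {f} x f≈0 = subst (λ y → ∑ G f ≈ f y) (Inverse.strictlyInverseˡ enum x)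
    (sum-single (Inverse.from enum x) λ j j≢ → f≈0 _ λ eq →
      j≢ (sym (Inverse.inverseʳ enum (sym eq))))

  ·-distrib-∑ : ∀ m (f : V → ℝ) → m · ∑ G f ≈ ∑ G (λ u → m · f u)
  ·-distrib-∑ m f = ·-distrib-sum m (f ∘ Inverse.to enum)

  ∑-+ : ∀ (f g : V → ℝ) → ∑ G (λ u → f u + g u) ≈ ∑ G f + ∑ G g
  ∑-+ f g = ∑-distrib-+ (f ∘ Inverse.to enum) (g ∘ Inverse.to enum)

  ∑-swap : ∀ (f : V → V → ℝ) → ∑ G (λ u → ∑ G λ v → f u v) ≈ ∑ G (λ v → ∑ G λ u → f u v)
  ∑-swap f = ∑-comm λ i j → f (Inverse.to enum i) (Inverse.to enum j)

  ∑-sum : ∀ {n} (F : V → ℕ) (h : Fin n → V → ℝ) →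
          ∑ G (λ u → F u · sum (λ k → h k u)) ≈ sum (λ k → ∑ G λ u → F u · h k u)
  ∑-sum F h = ≈-trans (∑-cong λ u → ·-distrib-sum (F u) (λ k → h k u))
                      (∑-comm λ i k → F (Inverse.to enum i) · h k (Inverse.to enum i))

  -- The easy half of Kantorovich duality, with the negative part of the potential moved across.
  duality : ∀ {ρ σ π} (F F′ : V → ℕ) → (∀ u v → F u ℕ.≤ d u v ℕ.+ F′ v) → IsCoupling G ρ σ π →
            ∑ G (λ u → F u · ρ u) ≤ cost G π + ∑ G (λ v → F′ v · σ v)
  duality {ρ} {σ} {π} F F′ F≤ C = begin
    ∑ G (λ u → F u · ρ u)
      ≈⟨ ∑-cong (λ u → ×-congʳ (F u) (marginalˡ u)) ⟨
    ∑ G (λ u → F u · ∑ G (λ v → π u v))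
      ≈⟨ ∑-cong (λ u → ·-distrib-∑ (F u) (π u)) ⟩
    ∑ G (λ u → ∑ G λ v → F u · π u v)
      ≤⟨ ∑-mono-≤ (λ u → ∑-mono-≤ λ v → ·-monoˡ-≤ (0≤π u v) (F≤ u v)) ⟩
    ∑ G (λ u → ∑ G λ v → (d u v ℕ.+ F′ v) · π u v)
      ≈⟨ ∑-cong (λ u → ≈-trans (∑-cong λ v → ×-homo-+ (π u v) (d u v) (F′ v))
                                   (∑-+ (λ v → d u v · π u v) (λ v → F′ v · π u v))) ⟩
    ∑ G (λ u → ∑ G (λ v → d u v · π u v) + ∑ G (λ v → F′ v · π u v))
      ≈⟨ ∑-+ (λ u → ∑ G λ v → d u v · π u v) (λ u → ∑ G λ v → F′ v · π u v) ⟩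
    cost G π + ∑ G (λ u → ∑ G λ v → F′ v · π u v)
      ≈⟨ +-cong ≈-refl (∑-swap λ u v → F′ v · π u v) ⟩
    cost G π + ∑ G (λ v → ∑ G λ u → F′ v · π u v)
      ≈⟨ +-cong ≈-refl (∑-cong λ v → ·-distrib-∑ (F′ v) (λ u → π u v)) ⟨
    cost G π + ∑ G (λ v → F′ v · ∑ G (λ u → π u v))
      ≈⟨ +-cong ≈-refl (∑-cong λ v → ×-congʳ (F′ v) (marginalʳ v)) ⟩
    cost G π + ∑ G (λ v → F′ v · σ v) ∎
    where
    open ≤-Reasoning
    open IsCoupling C

  -- Each value is attained by a coupling, whose cost the other value bounds from below.
  W₁-unique : ∀ {ρ σ w w′} → IsW₁ G ρ σ w → IsW₁ G ρ σ w′ → w ≈ w′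
  W₁-unique ((π , C , c≈w) , w≤) ((π′ , C′ , c≈w′) , w′≤) =
    mk≈ (≤-trans (w≤ π′ C′) (_≈_.≤-fwd c≈w′)) (≤-trans (w′≤ π C) (_≈_.≤-fwd c≈w))

  -- Curvature is a relation, so a nonzero value refutes the value 0 only through uniqueness.
  curvature-unique : ∀ {α x y k k′} → IsCurvature G α x y k → IsCurvature G α x y k′ → k ≈ k′
  curvature-unique (_ , W , k≈) (_ , W′ , k′≈) =
    ≈-trans k≈ (≈-trans (1-‿cong (W₁-unique W W′)) (≈-sym k′≈))

  -- Enumerated neighbourhoods and their uniform measures

  record EnumeratesNeighbours {n} (x : V) (s : Fin n → V) : Set where
    field
      injective  : ∀ {j k} → s j ≡ s k → j ≡ k
      adjacent   : ∀ k → x ~ s k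
      exhaustive : ∀ {z} → x ~ z → ∃ λ k → s k ≡ z

    -- The filtered vertex list and `tabulate s` are duplicate-free with the same members, hence
    -- permutations of each other.
    degree≡ : degree G x ≡ n
    degree≡ = trans
      (↭-length (∼bag⇒↭ (unique∧set⇒bag
        (Unique.filter⁺ (x ~?_) (Unique.map⁺ (Injection.injective (↔⇒↣ enum)) (Unique.allFin⁺ order)))
        (Unique.tabulate⁺ injective)
        (mk⇔ to from))))
      (length-tabulate s)
      where
      to : ∀ {z} → z ∈ filter (x ~?_) (vertices G) → z ∈ tabulate s
      to z∈ with exhaustive (proj₂ (∈-filter⁻ (x ~?_) {xs = vertices G} z∈))
      ... | k , refl = ∈-tabulate⁺ k
      from : ∀ {z} → z ∈ tabulate s → z ∈ filter (x ~?_) (vertices G)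
      from z∈ with ∈-tabulate⁻ z∈
      ... | k , refl = ∈-filter⁺ (x ~?_) (∈-vertices G (s k)) (adjacent k)

  module _ {n : ℕ} .{{_ : NonZero n}} where

    1/n : ℝ
    1/n = fromℚ (ℤ.+ 1 ℚ./ n)

    0≤1/n : 0ℝ ≤ 1/n
    0≤1/n = pointwise-≤ λ _ → ℚ.nonNegative⁻¹ _ {{1/-nonNeg n}}

    1/n≤1 : 1/n ≤ 1ℝ
    1/n≤1 = pointwise-≤ λ _ → 1/-≤1 n

    -- Summing over indices, rather than testing membership in the image of `s`, lets this sum be
    -- interchanged with sums over vertices.
    uniform : (Fin n → V) → V → ℝ
    uniform s u = sum λ k → weight 1/n (s k ≟ u)

    ∑-uniform : ∀ (F : V → ℕ) s → ∑ G (λ u → F u · uniform s u) ≈ sumℕ (F ∘ s) · 1/n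
    ∑-uniform F s = begin-equality
      ∑ G (λ u → F u · uniform s u)                       ≈⟨ ∑-sum F (λ k u → weight 1/n (s k ≟ u)) ⟩
      sum (λ k → ∑ G λ u → F u · weight 1/n (s k ≟ u))    ≈⟨ sum-cong-≋ (λ k → ∑-single (s k) (λ u u≢ → zero-off k u u≢)) ⟩
      sum (λ k → F (s k) · weight 1/n (s k ≟ s k))        ≈⟨ sum-cong-≋ (λ k → ×-congʳ (F (s k)) (weight-yes (s k ≟ s k) refl)) ⟩
      sum (λ k → F (s k) · 1/n)                           ≈⟨ sum-· (F ∘ s) 1/n ⟩
      sumℕ (F ∘ s) · 1/n                                  ∎
      where
      open ≤-Reasoning
      zero-off : ∀ k u → u ≢ s k → F u · weight 1/n (s k ≟ u) ≈ 0ℝ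
      zero-off k u u≢ = ≈-trans (×-congʳ (F u) (weight-no (s k ≟ u) (u≢ ∘ sym))) (·-zeroʳ (F u))

    module _ {x s} (N : EnumeratesNeighbours {n} x s) where
      open EnumeratesNeighbours N

      -- At idleness 0 the vertex `x` has mass 0, as does every index sum there, the graph having no
      -- loops. At a neighbour, injectivity leaves exactly one nonzero term.
      μ≈uniform : ∀ u → μ G 0ℝ x u ≈ uniform s u
      μ≈uniform u with x ≟ u | x ~? u
      ... | yes refl | _ = ≈-sym (sum-0 λ k → weight-no (s k ≟ x) λ eq → ~-irrefl (subst (x ~_) eq (adjacent k)))
      ... | no _ | no ≁  = ≈-sym (sum-0 λ k → weight-no (s k ≟ u) λ eq → ≁ (subst (x ~_) eq (adjacent k)))
      ... | no _ | yes e with exhaustive e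
      ...   | k , refl = ≈-sym (begin-equality
        uniform s (s k)                            ≈⟨ sum-single k (λ j j≢k → weight-no (s j ≟ s k) (j≢k ∘ injective)) ⟩
        weight 1/n (s k ≟ s k)                     ≈⟨ weight-yes (s k ≟ s k) refl ⟩
        1/n                                        ≈⟨ share {{~⇒degree≢0 G e}} degree≡ ⟩
        ((1ℝ - 0ℝ) / degree G x) {{~⇒degree≢0 G e}}  ∎)
        where
        open ≤-Reasoning
        -- `mass` divides by `degree G x`; generalising the degree to `m` lets `degree≡` be matched
        -- with `refl`.
        share : ∀ {m} .{{_ : NonZero m}} → m ≡ n → 1/n ≈ (1ℝ - 0ℝ) / m
        share refl = pointwise-≈ λ _ → sym (ℚ.*-identityˡ _)

      uniform≤1 : ∀ u → uniform s u ≤ 1ℝ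
      uniform≤1 u with Fin.any? (λ k → s k ≟ u)
      ... | yes (k , refl) = begin
        uniform s (s k)         ≈⟨ sum-single k (λ j j≢k → weight-no (s j ≟ s k) (j≢k ∘ injective)) ⟩
        weight 1/n (s k ≟ s k)  ≈⟨ weight-yes (s k ≟ s k) refl ⟩
        1/n                     ≤⟨ 1/n≤1 ⟩
        1ℝ                      ∎
        where open ≤-Reasoning
      ... | no ∄k = begin
        uniform s u  ≈⟨ sum-0 (λ k → weight-no (s k ≟ u) λ eq → ∄k (k , eq)) ⟩
        0ℝ           ≤⟨ 0≤1/n ⟩
        1/n          ≤⟨ 1/n≤1 ⟩
        1ℝ           ∎
        where open ≤-Reasoning

    -- Couplings given by matchings

    matching : (s t : Fin n → V) → V → V → ℝ
    matching s t u v = sum λ k → weight 1/n ((s k ≟ u) ×-dec (t k ≟ v))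

    -- Once the sum over `k` is outermost, the mass of index `k` sits at the single pair
    -- `(s k , t k)`.
    cost-matching : ∀ s t → cost G (matching s t) ≈ sumℕ (λ k → d (s k) (t k)) · 1/n
    cost-matching s t = begin-equality
      cost G (matching s t)
        ≈⟨ ∑-cong (λ u → ∑-sum (d u) (λ k v → w k u v)) ⟩
      ∑ G (λ u → sum λ k → ∑ G λ v → d u v · w k u v)
        ≈⟨ ∑-comm (λ i k → ∑ G λ v → d (Inverse.to enum i) v · w k (Inverse.to enum i) v) ⟩
      sum (λ k → ∑ G λ u → ∑ G λ v → d u v · w k u v)
        ≈⟨ sum-cong-≋ (λ k → ∑-single (s k) λ u u≢ → ∑-0 λ v → zero-off k u v (u≢ ∘ sym ∘ proj₁)) ⟩
      sum (λ k → ∑ G λ v → d (s k) v · w k (s k) v)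
        ≈⟨ sum-cong-≋ (λ k → ∑-single (t k) λ v v≢ → zero-off k (s k) v (v≢ ∘ sym ∘ proj₂)) ⟩
      sum (λ k → d (s k) (t k) · w k (s k) (t k))
        ≈⟨ sum-cong-≋ (λ k → ×-congʳ (d (s k) (t k)) (weight-yes ((s k ≟ s k) ×-dec (t k ≟ t k)) (refl , refl))) ⟩
      sum (λ k → d (s k) (t k) · 1/n)
        ≈⟨ sum-· (λ k → d (s k) (t k)) 1/n ⟩
      sumℕ (λ k → d (s k) (t k)) · 1/n ∎
      where
      open ≤-Reasoning
      w : Fin n → V → V → ℝ
      w k u v = weight 1/n ((s k ≟ u) ×-dec (t k ≟ v))
      zero-off : ∀ k u v → ¬ (s k ≡ u × t k ≡ v) → d u v · w k u v ≈ 0ℝ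
      zero-off k u v ≢ = ≈-trans (×-congʳ (d u v) (weight-no ((s k ≟ u) ×-dec (t k ≟ v)) ≢)) (·-zeroʳ (d u v))

    matching-marginalˡ : ∀ s t u → ∑ G (λ v → matching s t u v) ≈ uniform s u
    matching-marginalˡ s t u = begin-equality
      ∑ G (λ v → matching s t u v)
        ≈⟨ ∑-comm (λ i k → weight 1/n ((s k ≟ u) ×-dec (t k ≟ Inverse.to enum i))) ⟩
      sum (λ k → ∑ G λ v → weight 1/n ((s k ≟ u) ×-dec (t k ≟ v)))
        ≈⟨ sum-cong-≋ (λ k → ∑-single (t k) λ v v≢ → weight-no ((s k ≟ u) ×-dec (t k ≟ v)) (v≢ ∘ sym ∘ proj₂)) ⟩
      sum (λ k → weight 1/n ((s k ≟ u) ×-dec (t k ≟ t k)))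
        ≈⟨ sum-cong-≋ (λ k → weight-⇔ ((s k ≟ u) ×-dec (t k ≟ t k)) (s k ≟ u) proj₁ (_, refl)) ⟩
      uniform s u ∎
      where open ≤-Reasoning

    matching-marginalʳ : ∀ s t v → ∑ G (λ u → matching s t u v) ≈ uniform t v
    matching-marginalʳ s t v = begin-equality
      ∑ G (λ u → matching s t u v)
        ≈⟨ ∑-cong (λ u → sum-cong-≋ λ k → weight-⇔ ((s k ≟ u) ×-dec (t k ≟ v)) ((t k ≟ v) ×-dec (s k ≟ u))
                           (λ (p , q) → q , p) (λ (p , q) → q , p)) ⟩
      ∑ G (λ u → matching t s v u)
        ≈⟨ matching-marginalˡ t s v ⟩
      uniform t v ∎
      where open ≤-Reasoning

    module _ {x y s t} (Nˣ : EnumeratesNeighbours {n} x s) (Nʸ : EnumeratesNeighbours {n} y t) where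

      matching-isCoupling : IsCoupling G (μ G 0ℝ x) (μ G 0ℝ y) (matching s t)
      matching-isCoupling = record
        { 0≤π       = 0≤
        ; π≤1       = λ u v → begin
            -- An entry is at most its row sum, and the row sum is a value of `uniform s`.
            matching s t u v              ≤⟨ subst (λ z → matching s t u z ≤ _) (Inverse.strictlyInverseˡ enum v)
                                               (term≤sum (λ i → 0≤ u (Inverse.to enum i)) (Inverse.from enum v)) ⟩
            ∑ G (λ v → matching s t u v)  ≈⟨ matching-marginalˡ s t u ⟩
            uniform s u                   ≤⟨ uniform≤1 Nˣ u ⟩
            1ℝ                            ∎
        ; marginalˡ = λ u → ≈-trans (matching-marginalˡ s t u) (≈-sym (μ≈uniform Nˣ u))
        ; marginalʳ = λ v → ≈-trans (matching-marginalʳ s t v) (≈-sym (μ≈uniform Nʸ v))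
        }
        where
        open ≤-Reasoning
        0≤ : ∀ u v → 0ℝ ≤ matching s t u v
        0≤ u v = 0≤sum λ k → 0≤weight 0≤1/n ((s k ≟ u) ×-dec (t k ≟ v))

      -- Optimality from potentials on the neighbours

      module _ (f g : Fin n → ℕ) (f≤d+g : ∀ j k → f j ℕ.≤ d (s j) (t k) ℕ.+ g k) where

        private
          -- `duality` asks for potentials on all vertices, while certificates give them only on the
          -- neighbours.
          extend : (Fin n → V) → (Fin n → ℕ) → ℕ → V → ℕ
          extend r h m u with Fin.any? (λ k → r k ≟ u)
          ... | yes (k , _) = h k
          ... | no _        = m

          extend-≡ : ∀ {z r} → EnumeratesNeighbours {n} z r → ∀ h m k → extend r h m (r k) ≡ h k
          extend-≡ {r = r} N h m k with Fin.any? (λ j → r j ≟ r k)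
          ... | yes (j , eq) = cong h (EnumeratesNeighbours.injective N eq)
          ... | no ∄j        = contradiction (k , refl) ∄j

          term≤sumℕ : ∀ {n} (h : Fin n → ℕ) k → h k ℕ.≤ sumℕ h
          term≤sumℕ h zero    = ℕ.m≤m+n _ _
          term≤sumℕ h (suc k) = ℕ.≤-trans (term≤sumℕ (h ∘ suc) k) (ℕ.m≤n+m _ _)

          F F′ : V → ℕ
          -- The defaults keep the potential inequality true off the neighbourhoods: 0 is below
          -- everything, and `sumℕ f` is above every value of `f`.
          F  = extend s f 0
          F′ = extend t g (sumℕ f)

          F≤d+F′ : ∀ u v → F u ℕ.≤ d u v ℕ.+ F′ v
          F≤d+F′ u v with Fin.any? (λ k → s k ≟ u) | Fin.any? (λ k → t k ≟ v)
          ... | no _           | _              = z≤n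
          ... | yes (j , refl) | yes (k , refl) = f≤d+g j k
          ... | yes (j , refl) | no _           = ℕ.≤-trans (term≤sumℕ f j) (ℕ.m≤n+m _ _)

          sumℕ-cong : ∀ {n} {h h′ : Fin n → ℕ} → (∀ k → h k ≡ h′ k) → sumℕ h ≡ sumℕ h′
          sumℕ-cong {zero}  eq = refl
          sumℕ-cong {suc n} eq = cong₂ ℕ._+_ (eq zero) (sumℕ-cong (eq ∘ suc))

          -- The measure is supported on the image of `r`, where the extension agrees with `h`, so
          -- the default `m` drops out.
          expectation : ∀ {z r} → EnumeratesNeighbours {n} z r → ∀ h m →
                        ∑ G (λ u → extend r h m u · μ G 0ℝ z u) ≈ sumℕ h · 1/n
          expectation {z} {r} N h m = begin-equality
            ∑ G (λ u → extend r h m u · μ G 0ℝ z u)   ≈⟨ ∑-cong (λ u → ×-congʳ (extend r h m u) (μ≈uniform N u)) ⟩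
            ∑ G (λ u → extend r h m u · uniform r u)  ≈⟨ ∑-uniform (extend r h m) r ⟩
            sumℕ (extend r h m ∘ r) · 1/n             ≡⟨ cong (_· 1/n) (sumℕ-cong (extend-≡ N h m)) ⟩
            sumℕ h · 1/n                              ∎
            where open ≤-Reasoning

        -- Potentials are natural numbers, so the dual value is not written as a difference: the
        -- total of `g` is added on both sides and cancelled at the end.
        cost-lowerBound : ∀ {w} → sumℕ f ≡ w ℕ.+ sumℕ g →
                          ∀ π → IsCoupling G (μ G 0ℝ x) (μ G 0ℝ y) π → w · 1/n ≤ cost G π
        cost-lowerBound {w} eq π C = +-cancelʳ-≤ (sumℕ g · 1/n) (begin
          w · 1/n + sumℕ g · 1/n                    ≈⟨ ×-homo-+ 1/n w (sumℕ g) ⟨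
          (w ℕ.+ sumℕ g) · 1/n                      ≡⟨ cong (_· 1/n) eq ⟨
          sumℕ f · 1/n                              ≈⟨ expectation Nˣ f 0 ⟨
          ∑ G (λ u → F u · μ G 0ℝ x u)              ≤⟨ duality F F′ F≤d+F′ C ⟩
          cost G π + ∑ G (λ v → F′ v · μ G 0ℝ y v)  ≈⟨ +-cong ≈-refl (expectation Nʸ g (sumℕ f)) ⟩
          cost G π + sumℕ g · 1/n                   ∎)
          where open ≤-Reasoning

        isW₁ : ∀ {w} → sumℕ f ≡ w ℕ.+ sumℕ g → sumℕ (λ k → d (s k) (t k)) ℕ.≤ w →
               IsW₁ G (μ G 0ℝ x) (μ G 0ℝ y) (w · 1/n)
        isW₁ {w} eq d≤w =
          (matching s t , matching-isCoupling ,
            mk≈ (≤-trans (_≈_.≤-fwd (cost-matching s t)) (·-monoˡ-≤ 0≤1/n d≤w))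
                (cost-lowerBound eq (matching s t) matching-isCoupling)) ,
          cost-lowerBound eq

-- Residues modulo 5q

⊕-⊕ : ∀ {n} (i : Fin n) k l → (i ⊕ k) ⊕ l ≡ i ⊕ (k ℕ.+ l)
⊕-⊕ i zero    l = cong (_⊕ l) (⊕-0 i)
⊕-⊕ i (suc k) l = begin
  (i ⊕ suc k) ⊕ l      ≡⟨ cong (_⊕ l) (⊕-1 i k) ⟩
  ((i ⊕ 1) ⊕ k) ⊕ l    ≡⟨ ⊕-⊕ (i ⊕ 1) k l ⟩
  (i ⊕ 1) ⊕ (k ℕ.+ l)  ≡⟨ ⊕-1 i (k ℕ.+ l) ⟨
  i ⊕ suc (k ℕ.+ l)    ∎
  where open ≡-Reasoning

⊕-multiple : ∀ {n} (i : Fin n) k m → i ⊕ (k ℕ.+ m ℕ.* n) ≡ i ⊕ k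
⊕-multiple {n} i k m = Fin.toℕ-injective (begin
  toℕ (i ⊕ (k ℕ.+ m ℕ.* n))         ≡⟨ toℕ-⊕ i _ ⟩
  (toℕ i ℕ.+ (k ℕ.+ m ℕ.* n)) % n   ≡⟨ cong (_% n) (ℕ.+-assoc (toℕ i) k _) ⟨
  (toℕ i ℕ.+ k ℕ.+ m ℕ.* n) % n     ≡⟨ [m+kn]%n≡m%n (toℕ i ℕ.+ k) m n ⟩
  (toℕ i ℕ.+ k) % n                 ≡⟨ toℕ-⊕ i k ⟨
  toℕ (i ⊕ k)                       ∎)
  where
  open ≡-Reasoning
  instance _ = Fin.nonZeroIndex i

⊕-period : ∀ {n} (i : Fin n) → i ⊕ n ≡ i
⊕-period {n} i = begin
  i ⊕ n              ≡⟨ cong (i ⊕_) (ℕ.*-identityˡ n) ⟨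
  i ⊕ (0 ℕ.+ 1 ℕ.* n) ≡⟨ ⊕-multiple i 0 1 ⟩
  i ⊕ 0              ≡⟨ ⊕-0 i ⟩
  i                  ∎
  where open ≡-Reasoning

-- Adding `n ∸ k` undoes adding `k`.
⊕-cancelʳ : ∀ {n} {i j : Fin n} k → k ℕ.≤ n → i ⊕ k ≡ j ⊕ k → i ≡ j
⊕-cancelʳ {n} {i} {j} k k≤n eq = begin
  i                      ≡⟨ roundtrip i ⟨
  (i ⊕ k) ⊕ (n ℕ.∸ k)    ≡⟨ cong (_⊕ (n ℕ.∸ k)) eq ⟩
  (j ⊕ k) ⊕ (n ℕ.∸ k)    ≡⟨ roundtrip j ⟩
  j                      ∎
  where
  open ≡-Reasoning
  roundtrip : ∀ i → (i ⊕ k) ⊕ (n ℕ.∸ k) ≡ i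
  roundtrip i = trans (⊕-⊕ i k _) (trans (cong (i ⊕_) (ℕ.m+[n∸m]≡n k≤n)) (⊕-period i))

-- If `l < k`, then `i ⊕ k` arises from `i ⊕ l` by a shift strictly between 0 and `n`, so the two
-- differ; the other order is symmetric.
⊕-injectiveʳ : ∀ {n} (i : Fin n) {k l} → k ℕ.< n → l ℕ.< n → i ⊕ k ≡ i ⊕ l → k ≡ l
⊕-injectiveʳ {n} i k<n l<n eq = ℕ.≤-antisym (≮ k<n (sym eq)) (≮ l<n eq)
  where
  ≮ : ∀ {k l} → k ℕ.< n → i ⊕ l ≡ i ⊕ k → k ℕ.≤ l
  ≮ {k} {l} k<n eq = ℕ.≮⇒≥ λ l<k → i⊕k≢i (i ⊕ l) (k ℕ.∸ l) (ℕ.m<n⇒0<n∸m l<k) (ℕ.≤-<-trans (ℕ.m∸n≤m k l) k<n)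
    (trans eq (sym (trans (⊕-⊕ i l _) (cong (i ⊕_) (ℕ.m+[n∸m]≡n (ℕ.<⇒≤ l<k))))))

sumℕ-mono-≤ : ∀ {n} {h h′ : Fin n → ℕ} → (∀ k → h k ℕ.≤ h′ k) → sumℕ h ℕ.≤ sumℕ h′
sumℕ-mono-≤ {zero}  h≤ = z≤n
sumℕ-mono-≤ {suc n} h≤ = ℕ.+-mono-≤ (h≤ zero) (sumℕ-mono-≤ (h≤ ∘ suc))

-- The grid model and its decidable certificates

-- A grid vertex (c , e) stands for the residue cq + e relative to a base point. For
-- e < 5 ≤ q this is injective, so that questions about vertices near an edge become
-- decidable uniformly in q.
Grid : Set
Grid = (Fin 5 × ℕ) ⊎ (Fin 5 × ℕ)

_≟_ : DecidableEquality Grid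
_≟_ = Sum.≡-dec (Product.≡-dec Fin._≟_ ℕ._≟_) (Product.≡-dec Fin._≟_ ℕ._≟_)

height : Grid → ℕ
height (a (_ , e)) = e
height (b (_ , e)) = e

-- The orders are chosen so that, for every edge considered, an optimal transport sends the k-th
-- neighbour of one end to the k-th neighbour of the other. Junk at height 0, where pred is stuck.
neighbour : Grid → Fin 5 → Grid
neighbour (a (c , e)) = lookup
  (a (c , suc e) ∷ a (c , ℕ.pred e) ∷ a (c ⊕ 1 , e) ∷ a (c ⊕ 4 , e) ∷ b (c , e) ∷ [])
neighbour (b (c , e)) = lookup
  (b (c , suc e) ∷ b (c , ℕ.pred e) ∷ b (c ⊕ 3 , e) ∷ a (c , e) ∷ b (c ⊕ 2 , e) ∷ [])

-- Heights 1 to 3: `pred` is a genuine predecessor, and all neighbours have height below 5, where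
-- placement in the graph is injective.
Interior : Grid → Set
Interior u = 0 ℕ.< height u × suc (height u) ℕ.< 5

interior? : ∀ u → Dec (Interior u)
interior? u = (0 ℕ.<? height u) ×-dec (suc (height u) ℕ.<? 5)

height-neighbour : ∀ u k → Interior u → height (neighbour u k) ℕ.< 5
height-neighbour (a (c , e)) 0F (_ , e<4) = e<4
height-neighbour (a (c , e)) 1F (_ , e<4) = ℕ.≤-<-trans (ℕ.pred[n]≤n {e}) (ℕ.<⇒≤ e<4)
height-neighbour (a (c , e)) 2F (_ , e<4) = ℕ.<⇒≤ e<4
height-neighbour (a (c , e)) 3F (_ , e<4) = ℕ.<⇒≤ e<4
height-neighbour (a (c , e)) 4F (_ , e<4) = ℕ.<⇒≤ e<4
height-neighbour (b (c , e)) 0F (_ , e<4) = e<4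
height-neighbour (b (c , e)) 1F (_ , e<4) = ℕ.≤-<-trans (ℕ.pred[n]≤n {e}) (ℕ.<⇒≤ e<4)
height-neighbour (b (c , e)) 2F (_ , e<4) = ℕ.<⇒≤ e<4
height-neighbour (b (c , e)) 3F (_ , e<4) = ℕ.<⇒≤ e<4
height-neighbour (b (c , e)) 4F (_ , e<4) = ℕ.<⇒≤ e<4

-- Walks whose every step leaves an interior vertex; only the endpoint may lie on the boundary.
Reach : ℕ → Grid → Grid → Set
Reach zero    u v = u ≡ v
Reach (suc n) u v = Interior u × ∃ λ k → Reach n (neighbour u k) v

reach? : ∀ n u v → Dec (Reach n u v)
reach? zero    u v = u ≟ v
reach? (suc n) u v = interior? u ×-dec Fin.any? λ k → reach? n (neighbour u k) v

-- Distance truncated at 2, which is all that potentials with values at most 2 can detect. For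
-- interior `u`, equality and adjacency are decided exactly.
lowerDist : Grid → Grid → ℕ
lowerDist u v with reach? 0 u v | reach? 1 u v
... | yes _ | _     = 0
... | no _  | yes _ = 1
... | no _  | no _  = 2

-- ℓ bounds the cost of the matching of neighbours by w / 5, and the potentials f and g show that
-- no coupling is cheaper.
record Certificate (u v : Grid) (f g ℓ : Fin 5 → ℕ) (w : ℕ) : Set where
  constructor certificate
  field
    interiorᵘ  : Interior u
    interiorᵛ  : Interior v
    injectiveᵘ : ∀ i j → neighbour u i ≡ neighbour u j → i ≡ j
    injectiveᵛ : ∀ i j → neighbour v i ≡ neighbour v j → i ≡ j
    interior   : ∀ i → Interior (neighbour u i)
    feasible   : ∀ i j → f i ℕ.≤ lowerDist (neighbour u i) (neighbour v j) ℕ.+ g j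
    reach      : ∀ i → Reach (ℓ i) (neighbour u i) (neighbour v i)
    value      : sumℕ f ≡ w ℕ.+ sumℕ g
    short      : sumℕ ℓ ℕ.≤ w

certificate? : ∀ u v f g ℓ w → Dec (Certificate u v f g ℓ w)
certificate? u v f g ℓ w = map′
  (λ (p₁ , p₂ , p₃ , p₄ , p₅ , p₆ , p₇ , p₈ , p₉) → certificate p₁ p₂ p₃ p₄ p₅ p₆ p₇ p₈ p₉)
  (λ (certificate p₁ p₂ p₃ p₄ p₅ p₆ p₇ p₈ p₉) → p₁ , p₂ , p₃ , p₄ , p₅ , p₆ , p₇ , p₈ , p₉)
  (interior? u ×-dec interior? v
   ×-dec (Fin.all? λ i → Fin.all? λ j → (neighbour u i ≟ neighbour u j) →-dec (i Fin.≟ j))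
   ×-dec (Fin.all? λ i → Fin.all? λ j → (neighbour v i ≟ neighbour v j) →-dec (i Fin.≟ j))
   ×-dec (Fin.all? λ i → interior? (neighbour u i))
   ×-dec (Fin.all? λ i → Fin.all? λ j → f i ℕ.≤? lowerDist (neighbour u i) (neighbour v j) ℕ.+ g j)
   ×-dec (Fin.all? λ i → reach? (ℓ i) (neighbour u i) (neighbour v i))
   ×-dec (sumℕ f ℕ.≟ w ℕ.+ sumℕ g) ×-dec (sumℕ ℓ ℕ.≤? w))

-- Heights 2 and 3 keep both ends and all neighbours of the first end interior. The constant
-- potentials 1 and 0 are feasible because the neighbourhoods are disjoint. The conditions are
-- checked by evaluating `certificate?`.
certificate-a-1 : Certificate (a (0F , 2)) (a (0F , 3)) (λ _ → 1) (λ _ → 0) (λ _ → 1) 5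
certificate-a-1 = toWitness {a? = certificate? _ _ _ _ _ _} _

certificate-b-1 : Certificate (b (0F , 2)) (b (0F , 3)) (λ _ → 1) (λ _ → 0) (λ _ → 1) 5
certificate-b-1 = toWitness {a? = certificate? _ _ _ _ _ _} _

-- The matched pair at distance 2 is b_i, b_{i+q}, joined by two steps of -2q, since -4q = q modulo
-- 5q.
certificate-a-q : Certificate (a (0F , 2)) (a (1F , 2))
  (lookup (1 ∷ 1 ∷ 1 ∷ 2 ∷ 2 ∷ [])) (lookup (0 ∷ 0 ∷ 0 ∷ 1 ∷ 0 ∷ [])) (lookup (1 ∷ 1 ∷ 1 ∷ 1 ∷ 2 ∷ [])) 6
certificate-a-q = toWitness {a? = certificate? _ _ _ _ _ _} _

-- The matched pair at distance 2 is a_i, a_{i+2q}, joined by two steps of q.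
certificate-b-2q : Certificate (b (0F , 2)) (b (2F , 2))
  (lookup (1 ∷ 1 ∷ 2 ∷ 2 ∷ 1 ∷ [])) (lookup (0 ∷ 0 ∷ 1 ∷ 0 ∷ 0 ∷ [])) (lookup (1 ∷ 1 ∷ 1 ∷ 2 ∷ 1 ∷ [])) 6
certificate-b-2q = toWitness {a? = certificate? _ _ _ _ _ _} _

-- The matched pair at distance 2 is a_{i+q}, b_{i-2q}, joined through b_{i+q}, since q + 2q = -2q
-- modulo 5q.
certificate-a-b : Certificate (a (0F , 2)) (b (0F , 2))
  (lookup (1 ∷ 1 ∷ 2 ∷ 2 ∷ 1 ∷ [])) (lookup (0 ∷ 0 ∷ 0 ∷ 1 ∷ 0 ∷ [])) (lookup (1 ∷ 1 ∷ 2 ∷ 1 ∷ 1 ∷ [])) 6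
certificate-a-b = toWitness {a? = certificate? _ _ _ _ _ _} _

-- Placing the grid in the graph around a base point

module _ (q : ℕ) (q≥5 : 5 ℕ.≤ q) (o : Fin (5 ℕ.* q)) where

  private
    G = H q q≥5

  offset : Fin 5 × ℕ → ℕ
  offset (c , e) = toℕ c ℕ.* q ℕ.+ e

  at : Fin 5 × ℕ → Fin (5 ℕ.* q)
  at p = o ⊕ offset p

  place : Grid → Graph.V G
  place = Sum.map at at

  offset< : ∀ c {e} → e ℕ.< 5 → offset (c , e) ℕ.< 5 ℕ.* q
  offset< c {e} e<5 = begin-strict
    toℕ c ℕ.* q ℕ.+ e  <⟨ ℕ.+-monoʳ-< _ (ℕ.<-≤-trans e<5 q≥5) ⟩
    toℕ c ℕ.* q ℕ.+ q  ≡⟨ ℕ.+-comm _ q ⟩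
    suc (toℕ c) ℕ.* q  ≤⟨ ℕ.*-monoˡ-≤ q (Fin.toℕ<n c) ⟩
    5 ℕ.* q            ∎
    where open ℕ.≤-Reasoning

  -- Both offsets are below 5q, so equal residues have equal offsets; the remainder modulo q
  -- recovers `e`, and cancellation recovers `c`.
  at-injective : ∀ {c e c′ e′} → e ℕ.< 5 → e′ ℕ.< 5 → at (c , e) ≡ at (c′ , e′) → (c , e) ≡ (c′ , e′)
  at-injective {c} {e} {c′} {e′} e<5 e′<5 eq =
    cong₂ _,_ (Fin.toℕ-injective (ℕ.*-cancelʳ-≡ (toℕ c) (toℕ c′) q
                (ℕ.+-cancelʳ-≡ e _ _ (trans offset≡ (cong (toℕ c′ ℕ.* q ℕ.+_) (sym e≡e′)))))) e≡e′
    where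
    open ≡-Reasoning
    instance _ = ℕ.>-nonZero (ℕ.<-≤-trans (s≤s z≤n) q≥5)
    offset≡ : offset (c , e) ≡ offset (c′ , e′)
    offset≡ = ⊕-injectiveʳ o (offset< c e<5) (offset< c′ e′<5) eq
    offset%q : ∀ c {e} → e ℕ.< 5 → offset (c , e) % q ≡ e
    offset%q c {e} e<5 = begin
      (toℕ c ℕ.* q ℕ.+ e) % q  ≡⟨ cong (_% q) (ℕ.+-comm _ e) ⟩
      (e ℕ.+ toℕ c ℕ.* q) % q  ≡⟨ [m+kn]%n≡m%n e (toℕ c) q ⟩
      e % q                    ≡⟨ m<n⇒m%n≡m (ℕ.<-≤-trans e<5 q≥5) ⟩
      e                        ∎
    e≡e′ : e ≡ e′
    e≡e′ = trans (sym (offset%q c e<5)) (trans (cong (_% q) offset≡) (offset%q c′ e′<5))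

  place-injective : ∀ {u v} → height u ℕ.< 5 → height v ℕ.< 5 → place u ≡ place v → u ≡ v
  place-injective {a _} {a _} u<5 v<5 eq = cong inj₁ (at-injective u<5 v<5 (Sum.inj₁-injective eq))
  place-injective {b _} {b _} u<5 v<5 eq = cong inj₂ (at-injective u<5 v<5 (Sum.inj₂-injective eq))

  at-suc : ∀ c e → at (c , suc e) ≡ at (c , e) ⊕ 1
  at-suc c e = sym (trans (⊕-⊕ o _ 1) (cong (o ⊕_) (trans (ℕ.+-assoc (toℕ c ℕ.* q) e 1) (cong (toℕ c ℕ.* q ℕ.+_) (ℕ.+-comm e 1)))))

  -- Wrapping around modulo 5 in the first coordinate removes a multiple of 5q, which vanishes among
  -- the residues.
  at-⊕ : ∀ c e k → at (c ⊕ k , e) ≡ at (c , e) ⊕ (k ℕ.* q)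
  at-⊕ c e k = begin
    o ⊕ (toℕ (c ⊕ k) ℕ.* q ℕ.+ e)                          ≡⟨ cong (λ x → o ⊕ (x ℕ.* q ℕ.+ e)) (toℕ-⊕ c k) ⟩
    o ⊕ (m % 5 ℕ.* q ℕ.+ e)                                ≡⟨ ⊕-multiple o _ (m /ℕ 5) ⟨
    o ⊕ (m % 5 ℕ.* q ℕ.+ e ℕ.+ m /ℕ 5 ℕ.* (5 ℕ.* q))       ≡⟨ cong (o ⊕_) (regroup (m % 5) (m /ℕ 5) q e) ⟩
    o ⊕ ((m % 5 ℕ.+ m /ℕ 5 ℕ.* 5) ℕ.* q ℕ.+ e)             ≡⟨ cong (λ x → o ⊕ (x ℕ.* q ℕ.+ e)) (m≡m%n+[m/n]*n m 5) ⟨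
    o ⊕ ((toℕ c ℕ.+ k) ℕ.* q ℕ.+ e)                        ≡⟨ cong (o ⊕_) (swap (toℕ c) k q e) ⟩
    o ⊕ (toℕ c ℕ.* q ℕ.+ e ℕ.+ k ℕ.* q)                    ≡⟨ ⊕-⊕ o _ _ ⟨
    at (c , e) ⊕ (k ℕ.* q)                                 ∎
    where
    open ≡-Reasoning
    m = toℕ c ℕ.+ k
    open ℕ-Solver
    regroup : ∀ r s q e → r ℕ.* q ℕ.+ e ℕ.+ s ℕ.* (5 ℕ.* q) ≡ (r ℕ.+ s ℕ.* 5) ℕ.* q ℕ.+ e
    regroup = solve 4 (λ r s q e → r :* q :+ e :+ s :* (con 5 :* q) := (r :+ s :* con 5) :* q :+ e) refl
    swap : ∀ c k q e → (c ℕ.+ k) ℕ.* q ℕ.+ e ≡ c ℕ.* q ℕ.+ e ℕ.+ k ℕ.* q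
    swap = solve 4 (λ c k q e → (c :+ k) :* q :+ e := c :* q :+ e :+ k :* q) refl

  -- Subtraction of `k` is addition of `5 ∸ k` in the first coordinate, stated in the form of the
  -- second disjunct of `_≡_±_`.
  at-⊖ : ∀ c e k → k ℕ.≤ 5 → at (c , e) ≡ at (c ⊕ (5 ℕ.∸ k) , e) ⊕ (k ℕ.* q)
  at-⊖ c e k k≤5 = trans (cong (λ x → at (x , e)) (sym back)) (at-⊕ (c ⊕ (5 ℕ.∸ k)) e k)
    where
    back : (c ⊕ (5 ℕ.∸ k)) ⊕ k ≡ c
    back = trans (⊕-⊕ c _ k) (trans (cong (c ⊕_) (ℕ.m∸n+n≡m k≤5)) (⊕-period c))

  1≤5q : 1 ℕ.≤ 5 ℕ.* q
  1≤5q = ℕ.≤-trans (ℕ.≤-trans (s≤s z≤n) q≥5) (ℕ.m≤m+n q _)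

  ±1⇒at : ∀ c e {j} → j ≡ at (c , suc e) ± 1 → at (c , suc (suc e)) ≡ j ⊎ at (c , e) ≡ j
  ±1⇒at c e (inj₁ j≡) = inj₁ (trans (at-suc c (suc e)) (sym j≡))
  ±1⇒at c e (inj₂ ≡j) = inj₂ (⊕-cancelʳ 1 1≤5q (trans (sym (at-suc c e)) ≡j))

  ±kq⇒at : ∀ c e {j} k → k ℕ.≤ 5 → j ≡ at (c , e) ± (k ℕ.* q) → at (c ⊕ k , e) ≡ j ⊎ at (c ⊕ (5 ℕ.∸ k) , e) ≡ j
  ±kq⇒at c e k k≤5 (inj₁ j≡) = inj₁ (trans (at-⊕ c e k) (sym j≡))
  ±kq⇒at c e k k≤5 (inj₂ ≡j) = inj₂ (⊕-cancelʳ (k ℕ.* q) (ℕ.*-monoˡ-≤ q k≤5) (trans (sym (at-⊖ c e k k≤5)) ≡j))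

  ±q⇔ : ∀ {n} {i j : Fin n} → (j ≡ i ± q → j ≡ i ± (1 ℕ.* q)) × (j ≡ i ± (1 ℕ.* q) → j ≡ i ± q)
  ±q⇔ {i = i} {j} = subst (j ≡ i ±_) (sym (ℕ.*-identityˡ q)) , subst (j ≡ i ±_) (ℕ.*-identityˡ q)

  neighbour-adjacent : ∀ u k → 0 ℕ.< height u → Adj q (place u) (place (neighbour u k))
  neighbour-adjacent (a (c , e))     0F _ = inj₁ (inj₁ (at-suc c e))
  neighbour-adjacent (a (c , suc e)) 1F _ = inj₁ (inj₂ (at-suc c e))
  neighbour-adjacent (a (c , e))     2F _ = inj₂ (proj₂ ±q⇔ (inj₁ (at-⊕ c e 1)))
  neighbour-adjacent (a (c , e))     3F _ = inj₂ (proj₂ ±q⇔ (inj₂ (at-⊖ c e 1 (s≤s z≤n))))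
  neighbour-adjacent (a (c , e))     4F _ = refl
  neighbour-adjacent (b (c , e))     0F _ = inj₁ (inj₁ (at-suc c e))
  neighbour-adjacent (b (c , suc e)) 1F _ = inj₁ (inj₂ (at-suc c e))
  neighbour-adjacent (b (c , e))     2F _ = inj₂ (inj₂ (at-⊖ c e 2 (s≤s (s≤s z≤n))))
  neighbour-adjacent (b (c , e))     3F _ = refl
  neighbour-adjacent (b (c , e))     4F _ = inj₂ (inj₁ (at-⊕ c e 2))

  neighbour-exhaustive : ∀ u {z} → 0 ℕ.< height u → Adj q (place u) z → ∃ λ k → place (neighbour u k) ≡ z
  neighbour-exhaustive (a (c , suc e)) {a j} _ (inj₁ ±1) with ±1⇒at c e ±1
  ... | inj₁ eq = 0F , cong inj₁ eq
  ... | inj₂ eq = 1F , cong inj₁ eq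
  neighbour-exhaustive (a (c , suc e)) {a j} _ (inj₂ ±q) with ±kq⇒at c (suc e) 1 (s≤s z≤n) (proj₁ ±q⇔ ±q)
  ... | inj₁ eq = 2F , cong inj₁ eq
  ... | inj₂ eq = 3F , cong inj₁ eq
  neighbour-exhaustive (a (c , suc e)) {b j} _ eq = 4F , cong inj₂ eq
  neighbour-exhaustive (b (c , suc e)) {b j} _ (inj₁ ±1) with ±1⇒at c e ±1
  ... | inj₁ eq = 0F , cong inj₂ eq
  ... | inj₂ eq = 1F , cong inj₂ eq
  neighbour-exhaustive (b (c , suc e)) {b j} _ (inj₂ ±2q) with ±kq⇒at c (suc e) 2 (s≤s (s≤s z≤n)) ±2q
  ... | inj₁ eq = 4F , cong inj₂ eq
  ... | inj₂ eq = 2F , cong inj₂ eq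
  neighbour-exhaustive (b (c , suc e)) {a j} _ eq = 3F , cong inj₁ eq

  enumerates : ∀ u → Interior u → (∀ j k → neighbour u j ≡ neighbour u k → j ≡ k) →
               EnumeratesNeighbours G (place u) (place ∘ neighbour u)
  enumerates u int@(0<e , _) inj = record
    { injective  = λ {j} {k} eq → inj j k
        (place-injective (height-neighbour u j int) (height-neighbour u k int) eq)
    ; adjacent   = λ k → neighbour-adjacent u k 0<e
    ; exhaustive = neighbour-exhaustive u 0<e
    }

  reach⇒walk : ∀ {n u v} → Reach n u v → Walk (Adj q) n (place u) (place v)
  reach⇒walk {zero}      refl                    = []
  reach⇒walk {suc n} {u} ((0<e , _) , k , reach) = neighbour-adjacent u k 0<e ∷ reach⇒walk reach

  -- Vertices at distance 0 coincide, and those at distance 1 are joined by an edge that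
  -- `neighbour-exhaustive` lists. `place-injective` carries both facts back to the grid, against
  -- the failed tests.
  lowerDist≤dist : ∀ u v → Interior u → height v ℕ.< 5 → lowerDist u v ℕ.≤ dist G (place u) (place v)
  lowerDist≤dist u v int@(0<e , e<4) v<5
    with reach? 0 u v | reach? 1 u v | dist G (place u) (place v) | dist-walk G (place u) (place v)
  ... | yes _  | _     | _           | _      = z≤n
  ... | no u≢v | _     | zero        | w      = contradiction (place-injective (ℕ.<⇒≤ e<4) v<5 (empty w)) u≢v
    where
    empty : ∀ {x y} → Walk (Adj q) 0 x y → x ≡ y
    empty [] = refl
  ... | no _   | yes _ | suc _       | _      = s≤s z≤n
  ... | no _   | no ↛  | suc zero    | e ∷ [] with neighbour-exhaustive u 0<e e
  ...   | k , eq = contradiction (int , k , place-injective (height-neighbour u k int) v<5 eq) ↛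
  lowerDist≤dist u v int v<5 | no _ | no _ | suc (suc _) | _ = s≤s (s≤s z≤n)

  -- Feasibility passes from `lowerDist` to the true distance, which is larger, and grid walks bound
  -- the cost of the matching; both bounds meet at `w` fifths.
  curvature : ∀ {u v f g ℓ w k} → Certificate u v f g ℓ w → k ≈ 1ℝ - w · fromℚ (ℤ.+ 1 ℚ./ 5) →
              IsCurvature G 0ℝ (place u) (place v) k
  curvature {u} {v} {f} {g} {ℓ} {w} C k≈ =
    w · fromℚ (ℤ.+ 1 ℚ./ 5) ,
    isW₁ G (enumerates u interiorᵘ injectiveᵘ) (enumerates v interiorᵛ injectiveᵛ) f g f≤dist+g value Σdist≤w ,
    k≈
    where
    open Certificate C
    f≤dist+g : ∀ i j → f i ℕ.≤ dist G (place (neighbour u i)) (place (neighbour v j)) ℕ.+ g j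
    f≤dist+g i j = ℕ.≤-trans (feasible i j) (ℕ.+-monoˡ-≤ (g j)
      (lowerDist≤dist (neighbour u i) (neighbour v j) (interior i) (height-neighbour v j interiorᵛ)))
    Σdist≤w : sumℕ (λ k → dist G (place (neighbour u k)) (place (neighbour v k))) ℕ.≤ w
    Σdist≤w = ℕ.≤-trans (sumℕ-mono-≤ λ k → dist-≤ G (reach⇒walk (reach k))) short

  curvature-a-1 : IsCurvature G 0ℝ (a (at (0F , 2))) (a (at (0F , 3))) 0ℝ
  curvature-a-1 = curvature certificate-a-1 (pointwise-≈ λ _ → refl)

  curvature-b-1 : IsCurvature G 0ℝ (b (at (0F , 2))) (b (at (0F , 3))) 0ℝ
  curvature-b-1 = curvature certificate-b-1 (pointwise-≈ λ _ → refl)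

  curvature-a-q : IsCurvature G 0ℝ (a (at (0F , 2))) (a (at (1F , 2))) (fromℚ (ℤ.-1ℤ ℚ./ 5))
  curvature-a-q = curvature certificate-a-q (pointwise-≈ λ _ → refl)

  curvature-b-2q : IsCurvature G 0ℝ (b (at (0F , 2))) (b (at (2F , 2))) (fromℚ (ℤ.-1ℤ ℚ./ 5))
  curvature-b-2q = curvature certificate-b-2q (pointwise-≈ λ _ → refl)

  curvature-a-b : IsCurvature G 0ℝ (a (at (0F , 2))) (b (at (0F , 2))) (fromℚ (ℤ.-1ℤ ℚ./ 5))
  curvature-a-b = curvature certificate-a-b (pointwise-≈ λ _ → refl)

-- Curvatures at an arbitrary index

module _ (q : ℕ) (q≥5 : 5 ℕ.≤ q) (i : Fin (5 ℕ.* q)) where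

  private
    -- With i at height 2, both ends of every edge and all neighbours of i are interior.
    o : Fin (5 ℕ.* q)
    o = i ⊕ (5 ℕ.* q ℕ.∸ 2)

    i≡ : at q q≥5 o (0F , 2) ≡ i
    i≡ = trans (⊕-⊕ i (5 ℕ.* q ℕ.∸ 2) 2) (trans (cong (i ⊕_) (ℕ.m∸n+n≡m 2≤5q)) (⊕-period i))
      where
      2≤5q : 2 ℕ.≤ 5 ℕ.* q
      2≤5q = ℕ.≤-trans (ℕ.≤-trans (s≤s (s≤s z≤n)) q≥5) (ℕ.m≤m+n q _)

    i+1≡ : at q q≥5 o (0F , 3) ≡ i ⊕ 1
    i+1≡ = trans (at-suc q q≥5 o 0F 2) (cong (_⊕ 1) i≡)

    i+kq≡ : ∀ k → at q q≥5 o (0F ⊕ k , 2) ≡ i ⊕ (k ℕ.* q)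
    i+kq≡ k = trans (at-⊕ q q≥5 o 0F 2 k) (cong (_⊕ (k ℕ.* q)) i≡)

  κ-a-1 : IsCurvature (H q q≥5) 0ℝ (a i) (a (i ⊕ 1)) 0ℝ
  κ-a-1 = subst₂ (λ i j → IsCurvature (H q q≥5) 0ℝ (a i) (a j) 0ℝ) i≡ i+1≡ (curvature-a-1 q q≥5 o)

  κ-b-1 : IsCurvature (H q q≥5) 0ℝ (b i) (b (i ⊕ 1)) 0ℝ
  κ-b-1 = subst₂ (λ i j → IsCurvature (H q q≥5) 0ℝ (b i) (b j) 0ℝ) i≡ i+1≡ (curvature-b-1 q q≥5 o)

  κ-a-q : IsCurvature (H q q≥5) 0ℝ (a i) (a (i ⊕ q)) (fromℚ (ℤ.-1ℤ ℚ./ 5))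
  κ-a-q = subst₂ (λ i j → IsCurvature (H q q≥5) 0ℝ (a i) (a j) (fromℚ (ℤ.-1ℤ ℚ./ 5))) i≡
    (trans (i+kq≡ 1) (cong (i ⊕_) (ℕ.*-identityˡ q))) (curvature-a-q q q≥5 o)

  κ-b-2q : IsCurvature (H q q≥5) 0ℝ (b i) (b (i ⊕ (2 ℕ.* q))) (fromℚ (ℤ.-1ℤ ℚ./ 5))
  κ-b-2q = subst₂ (λ i j → IsCurvature (H q q≥5) 0ℝ (b i) (b j) (fromℚ (ℤ.-1ℤ ℚ./ 5))) i≡ (i+kq≡ 2)
    (curvature-b-2q q q≥5 o)

  κ-a-b : IsCurvature (H q q≥5) 0ℝ (a i) (b i) (fromℚ (ℤ.-1ℤ ℚ./ 5))
  κ-a-b = subst (λ i → IsCurvature (H q q≥5) 0ℝ (a i) (b i) (fromℚ (ℤ.-1ℤ ℚ./ 5))) i≡ (curvature-a-b q q≥5 o)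

-- Failure of bone-idleness

0≰-1/5 : ¬ (0ℝ ≤ fromℚ (ℤ.-1ℤ ℚ./ 5))
-- The order holds up to every positive ε; 1/10 is small enough, as -1/5 + 1/10 is still negative.
0≰-1/5 (mk≤ bound) = let (N , 0≤) = bound (ℤ.+ 1 ℚ./ 10) (ℚ.positive⁻¹ _) in
  toWitnessFalse {a? = ℚ.0ℚ ℚ.≤? ℤ.-1ℤ ℚ./ 5 ℚ.+ ℤ.+ 1 ℚ./ 10} _ (0≤ N ℕ.≤-refl)

-- The edge a_i b_i at idleness 0 would have curvature both 0 and -1/5.
not-boneIdle : ∀ q q≥5 → ¬ BoneIdle (H q q≥5)
not-boneIdle q q≥5 idle = 0≰-1/5 (_≈_.≤-fwd (curvature-unique (H q q≥5) {0ℝ} {a i} {b i} κ≡0 (κ-a-b q q≥5 i)))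
  where
  i : Fin (5 ℕ.* q)
  i = fromℕ< (ℕ.≤-trans (ℕ.≤-trans (s≤s z≤n) q≥5) (ℕ.m≤m+n q _))
  κ≡0 : IsCurvature (H q q≥5) 0ℝ (a i) (b i) 0ℝ
  κ≡0 = idle (a i) (b i) refl 0ℝ ≤-refl (pointwise-≤ λ _ → ℚ.nonNegative⁻¹ ℚ.1ℚ)

theorem4p2 : (q : ℕ) (q≥5 : 5 ℕ.≤ q) →
    ((i : Fin (5 ℕ.* q)) →
    IsCurvature (H q q≥5) 0ℝ (a i) (a (i ⊕ 1)) 0ℝ
    × IsCurvature (H q q≥5) 0ℝ (b i) (b (i ⊕ 1)) 0ℝ
    × IsCurvature (H q q≥5) 0ℝ (a i) (a (i ⊕ q)) (fromℚ (ℤ.-1ℤ ℚ./ 5))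
    × IsCurvature (H q q≥5) 0ℝ (b i) (b (i ⊕ (2 ℕ.* q))) (fromℚ (ℤ.-1ℤ ℚ./ 5))
    × IsCurvature (H q q≥5) 0ℝ (a i) (b i) (fromℚ (ℤ.-1ℤ ℚ./ 5)))
    × ¬ BoneIdle (H q q≥5)
theorem4p2 q q≥5 =
  (λ i → κ-a-1 q q≥5 i , κ-b-1 q q≥5 i , κ-a-q q q≥5 i , κ-b-2q q q≥5 i , κ-a-b q q≥5 i) ,
  not-boneIdle q q≥5
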